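{- Let $\Gamma$ be a finitely generated infinite group. Then there is a coloring of the elements of $\Gamma$ with two colors such that the identity map is the only group endomorphism $\phi:\Gamma\to\Gamma$ satisfying $c(\phi(g)) = c(g)$ for all $g \in \Gamma$. In other words, finitely generated infinite groups are endomorphism $2$-distinguishable.
   Context: Here endomorphisms are group homomorphisms $\Gamma \to \Gamma$. -}

module Defs where

open import Level using (Level; _⊔_; suc)
open import Data.Nat using (ℕ)
open import Data.Fin using (Fin)
open import Data.Product using (Σ; ∃; _×_)
open import Relation.Nullary using (¬_)
open import Function.Bundles using (_⇔_)
open import Algebra.Bundles using (Group)
open import Algebra.Morphism.Structures using (module GroupMorphisms)

module _ {c ℓ : Level} (G : Group c ℓ) where
  open Group G

  data Word (n : ℕ) : Set where
    gen  : Fin n → Word n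
    unit : Word n
    inv  : Word n → Word n
    mul  : Word n → Word n → Word n

  eval : {n : ℕ} → (Fin n → Carrier) → Word n → Carrier
  eval s (gen i)   = s i
  eval s unit      = ε
  eval s (inv w)   = (eval s w) ⁻¹
  eval s (mul v w) = eval s v ∙ eval s w

  FinitelyGenerated : Set (c ⊔ ℓ)
  FinitelyGenerated =
    Σ ℕ λ n → Σ (Fin n → Carrier) λ s → ∀ g → ∃ λ (w : Word n) → eval s w ≈ g

  Finite : Set (c ⊔ ℓ)
  Finite = Σ ℕ λ n → Σ (Fin n → Carrier) λ f → ∀ g → ∃ λ (i : Fin n) → f i ≈ g

  Infinite : Set (c ⊔ ℓ)
  Infinite = ¬ Finite

  IsEndomorphism : (Carrier → Carrier) → Set (c ⊔ ℓ)
  IsEndomorphism φ = GroupMorphisms.IsGroupHomomorphism rawGroup rawGroup φ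

  -- a 2-coloring of G: a subset (the elements of colour 1), respecting ≈
  record TwoColoring : Set (suc (c ⊔ ℓ)) where
    field
      colour  : Carrier → Set (c ⊔ ℓ)
      respect : ∀ {x y} → x ≈ y → colour x → colour y

  open TwoColoring public

  Preserves : TwoColoring → (Carrier → Carrier) → Set (c ⊔ ℓ)
  Preserves C φ = ∀ g → colour C (φ g) ⇔ colour C g

  EndoTwoDistinguishable : Set (suc (c ⊔ ℓ))
  EndoTwoDistinguishable =
    Σ TwoColoring λ C → ∀ φ → IsEndomorphism φ → Preserves C φ → ∀ g → φ g ≈ g

{-# OPTIONS --safe #-}
module Submission where

-- Classically one treats the countably many endomorphisms one after the other: each φ ≠ id moves
-- infinitely many elements, so a fresh g with φ g ≠ g can be given another colour than φ g.
-- Equality in G being undecidable, this greedy colouring only shows that φ = id is not false.  To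
-- obtain φ = id itself, more elements are dropped, depending on the proposition B = (φ = id): work
-- modulo B (the monad A ↦ (A → B) → B), where ≈ is classical, and let K be the set of those k for
-- which B implies k ≈ ε.  Then G / K is infinite, φ is the identity modulo K, and there are
-- canonical words, each the least one whose coset avoids the earlier ones.
--   If K has more than C elements, one element that need not be kept is dropped in each of the
--     cosets of g and g r, for r running over a few short words outside K; φ must fix both dropped
--     elements, hence r.
--   If K has at most C elements, then φ fixes all words acting trivially on every set of at most C
--     elements, so it suffices to fix one word in the class of each generator; all of its coset
--     except the word itself (and what must be kept) is dropped.
-- The colour of x combines this for all B at once.  The cases do not disturb each other because
-- "least" is monotone: passing to a coarser congruence, the canonical words of a finer one fall
-- into the cosets of boundedly many canonical elements, and these are never dropped.

open import Defs
open import Level using (Level; _⊔_; Lift; lift; lower)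
open import Algebra.Bundles using (Group)
open import Algebra.Morphism.Structures using (module GroupMorphisms)
import Algebra.Properties.Group
open import Data.Bool using (Bool; true; false; not)
open import Data.Empty using (⊥; ⊥-elim)
open import Data.Fin as Fin using (Fin; zero; suc; toℕ; fromℕ<; inject≤; combine)
open import Data.Fin.Properties
  using (all?; <-cmp; toℕ<n; fromℕ<-toℕ; toℕ-fromℕ<; inject≤-injective; combine-injective; pigeonhole)
open import Data.List as List using (List; []; _∷_; _++_; [_])
open import Data.List.Membership.Propositional using (_∈_; find; lose)
open import Data.List.Membership.Propositional.Properties
  using (∈-cartesianProductWith⁺; ∈-allFin; ∈-concatMap⁺; ∈-map⁺; ∈-lookup)
import Data.List.Properties as Listₚ
open import Data.List.Relation.Unary.All as All using (All; []; _∷_)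
open import Data.List.Relation.Unary.AllPairs as AllPairs using (AllPairs; []; _∷_)
open import Data.List.Relation.Unary.Any as Any using (Any; here; there)
import Data.List.Relation.Unary.Any.Properties as Anyₚ
open import Data.Nat using (ℕ; zero; suc; _+_; _*_; _^_; _<_; _≤_; s≤s; _<?_)
import Data.Nat.Properties as ℕ
open import Data.Product using (Σ; ∃; ∃₂; _×_; _,_; proj₁; proj₂)
open import Data.Sum as Sum using (_⊎_; inj₁; inj₂; [_,_]′)
open import Data.Vec as Vec using (Vec; []; _∷_)
import Data.Vec.Membership.Propositional as Vec∈
import Data.Vec.Membership.Propositional.Properties as Vec∈ₚ
import Data.Vec.Properties as Vecₚ
open import Data.Vec.Relation.Unary.Any using (here; there)
open import Function using (_∘_; id; case_of_)
open import Function.Bundles using (Equivalence)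
open import Relation.Binary.Definitions using (tri<; tri≈; tri>)
open import Relation.Binary.PropositionalEquality as ≡ using (_≡_)
open import Relation.Nullary using (¬_; Dec; yes; no)
open import Relation.Nullary.Decidable using (_×-dec_)

-- The monad A ↦ (A → B) → B: inside it classical reasoning is available, and a
-- proof of B may be extracted.
module Relative {b : Level} (B : Set b) where

  Cont : {a : Level} → Set a → Set (a ⊔ b)
  Cont A = (A → B) → B

  return : {a : Level} {A : Set a} → A → Cont A
  return x k = k x

  infixl 1 _>>=_
  _>>=_ : {a a′ : Level} {A : Set a} {A′ : Set a′} → Cont A → (A → Cont A′) → Cont A′
  (m >>= f) k = m λ x → f x k

  decide : {a : Level} (A : Set a) → Cont (A ⊎ (A → B))
  decide A k = k (inj₂ (k ∘ inj₁))

  collectFin : {a : Level} {n : ℕ} {P : Fin n → Set a} → (∀ i → Cont (P i)) → Cont (∀ i → P i)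
  collectFin {n = zero}  f k = k λ ()
  collectFin {n = suc n} f k =
    f zero λ p → collectFin (f ∘ suc) λ ps → k λ { zero → p ; (suc i) → ps i }

  collectAll : {a p : Level} {A : Set a} {P : A → Set p} (xs : List A) →
               (∀ {x} → x ∈ xs → Cont (P x)) → Cont (All P xs)
  collectAll []       f k = k []
  collectAll (x ∷ xs) f k = f (here ≡.refl) λ p → collectAll xs (f ∘ there) λ ps → k (p ∷ ps)

  -- The alternative to `P` is left free instead of being `P u → B`, so that minimality can be
  -- recorded positively, without mention of `B`.
  least : {p q : Level} {P : ℕ → Set p} {Q : ℕ → Set q} → (∀ u → Cont (P u ⊎ Q u)) →
          ∀ u → P u → Cont (∃ λ g → P g × (∀ u → u < g → Q u))
  least {P = P} {Q} dec u pu = below (suc u) >>= λ where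
      (inj₁ found) → return found
      (inj₂ none)  → return (u , pu , λ v v<u → none v (ℕ.m<n⇒m<1+n v<u))
    where
    below : ∀ m → Cont ((∃ λ g → P g × (∀ u → u < g → Q u)) ⊎ (∀ u → u < m → Q u))
    below zero    = return (inj₂ λ _ ())
    below (suc m) = below m >>= λ where
      (inj₁ found) → return (inj₁ found)
      (inj₂ none)  → dec m >>= λ where
        (inj₁ p) → return (inj₁ (m , p , none))
        (inj₂ q) → return (inj₂ λ u u<1+m → [ none u , (λ { ≡.refl → q }) ]′ (ℕ.m<1+n⇒m<n∨m≡n u<1+m))

  -- The representatives that are not found contribute the junk value d.
  representatives : {a : Level} {A : Set a} {N : ℕ} (d : A) (f : A → Fin N) →
                    Cont (∃ λ (vs : List A) → ∀ w → Cont (Any (λ v → f v ≡ f w) vs))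
  representatives {N = N} d f = collectFin (λ i → decide (∃ λ u → f u ≡ i)) >>= λ found →
    return (List.map (pick found) (List.allFin N) , λ w →
      cover found w (found (f w)) ≡.refl)
    where
    Found = ∀ i → (∃ λ u → f u ≡ i) ⊎ ((∃ λ u → f u ≡ i) → B)
    pick : Found → Fin N → _
    pick found i = [ proj₁ , (λ _ → d) ]′ (found i)
    cover : (found : Found) → ∀ w → (r : (∃ λ u → f u ≡ f w) ⊎ ((∃ λ u → f u ≡ f w) → B)) →
            found (f w) ≡ r → Cont (Any (λ v → f v ≡ f w) (List.map (pick found) (List.allFin N)))
    cover found w (inj₂ none) _ k = none (w , ≡.refl)
    cover found w (inj₁ (u , fu≡fw)) eq k =
      k (Anyₚ.map⁺ (Any.map (λ { ≡.refl → ≡.trans (≡.cong (f ∘ [ proj₁ , (λ _ → d) ]′) eq) fu≡fw }) (∈-allFin (f w))))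

alternatives : {a b : Level} {B : Set b} {n : ℕ} {P : Fin n → Set a} →
               (∀ i → B ⊎ P i) → B ⊎ (∀ i → P i)
alternatives {n = zero}  f = inj₂ λ ()
alternatives {n = suc n} f with f zero | alternatives (f ∘ suc)
... | inj₁ b | _       = inj₁ b
... | inj₂ _ | inj₁ b  = inj₁ b
... | inj₂ p | inj₂ ps = inj₂ λ { zero → p ; (suc i) → ps i }

-- Enumerations

-- Cantor's enumeration of pairs, along one antidiagonal after the other.
unpairStep : ℕ × ℕ → ℕ × ℕ
unpairStep (zero  , b) = suc b , zero
unpairStep (suc a , b) = a , suc b

unpair : ℕ → ℕ × ℕ
unpair zero    = zero , zero
unpair (suc k) = unpairStep (unpair k)

unpair-walk : ∀ b a k → unpair k ≡ (b + a , 0) → unpair (b + k) ≡ (a , b)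
unpair-walk zero    a k eq = eq
unpair-walk (suc b) a k eq =
  ≡.cong unpairStep (unpair-walk b (suc a) k (≡.trans eq (≡.cong (_, 0) (≡.sym (ℕ.+-suc b a)))))

unpair-diagonal : ∀ x → ∃ λ k → unpair k ≡ (x , 0)
unpair-diagonal zero    = 0 , ≡.refl
unpair-diagonal (suc x) with k , eq ← unpair-diagonal x =
  suc (x + k) , ≡.cong unpairStep (unpair-walk x 0 k (≡.trans eq (≡.cong (_, 0) (≡.sym (ℕ.+-identityʳ x)))))

unpair-surjective : ∀ a b → ∃ λ k → unpair k ≡ (a , b)
unpair-surjective a b with k , eq ← unpair-diagonal (b + a) = b + k , unpair-walk b a k eq

decodeVec : (n : ℕ) → ℕ → Vec ℕ n
decodeVec zero    k = []
decodeVec (suc n) k = proj₁ (unpair k) ∷ decodeVec n (proj₂ (unpair k))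

decodeVec-surjective : ∀ {n} (xs : Vec ℕ n) → ∃ λ k → decodeVec n k ≡ xs
decodeVec-surjective []       = 0 , ≡.refl
decodeVec-surjective (x ∷ xs)
  with j , eq ← decodeVec-surjective xs
  with k , eq′ ← unpair-surjective x j =
  k , ≡.cong₂ _∷_ (≡.cong proj₁ eq′) (≡.trans (≡.cong (decodeVec _ ∘ proj₂) eq′) eq)

-- A letter (i , false) stands for the inverse of the i-th generator.
Letter : ℕ → Set
Letter n = Fin n × Bool

FreeWord : ℕ → Set
FreeWord n = List (Letter n)

sign : ℕ → Bool
sign zero    = true
sign (suc _) = false

-- Pairs out of range decode to the empty word, so every pair is a code, even when `n` is zero.
letterAt : (n : ℕ) → ℕ × ℕ → FreeWord n
letterAt n (a , b) with a <? n
... | yes a<n = [ fromℕ< a<n , sign b ]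
... | no  _   = []

letterAt-surjective : ∀ {n} (l : Letter n) → ∃ λ p → letterAt n p ≡ [ l ]
letterAt-surjective {n} (i , b) = (toℕ i , code b) , eq b
  where
  code : Bool → ℕ
  code true  = 0
  code false = 1
  eq : ∀ b → letterAt n (toℕ i , code b) ≡ [ i , b ]
  eq b with toℕ i <? n
  eq true  | yes i<n = ≡.cong (λ j → [ j , true ]) (fromℕ<-toℕ i i<n)
  eq false | yes i<n = ≡.cong (λ j → [ j , false ]) (fromℕ<-toℕ i i<n)
  eq _     | no  i≮n = ⊥-elim (i≮n (toℕ<n i))

spell : (n : ℕ) {k : ℕ} → Vec ℕ k → FreeWord n
spell n []       = []
spell n (x ∷ xs) = letterAt n (unpair x) ++ spell n xs

spell-surjective : ∀ {n} (w : FreeWord n) → ∃₂ λ k (xs : Vec ℕ k) → spell n xs ≡ w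
spell-surjective []      = 0 , [] , ≡.refl
spell-surjective {n} (l ∷ w)
  with k , xs , eq ← spell-surjective w
  with p , eq′ ← letterAt-surjective l
  with x , eq″ ← unpair-surjective (proj₁ p) (proj₂ p) =
  suc k , x ∷ xs , ≡.cong₂ _++_ (≡.trans (≡.cong (letterAt n) eq″) eq′) eq

word : (n : ℕ) → ℕ → FreeWord n
word n k = spell n (decodeVec (proj₁ (unpair k)) (proj₂ (unpair k)))

word-surjective : ∀ {n} (w : FreeWord n) → ∃ λ k → word n k ≡ w
word-surjective {n} w
  with l , xs , eq ← spell-surjective w
  with j , eq′ ← decodeVec-surjective xs
  with k , eq″ ← unpair-surjective l j =
  k , ≡.trans (≡.cong (λ p → spell n (decodeVec (proj₁ p) (proj₂ p))) eq″) (≡.trans (≡.cong (spell n) eq′) eq)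

-- An endomorphism is determined by the images of the generators, so the numbers `m` enumerate all
-- endomorphisms, together with tuples that define none.
tuple : (n : ℕ) → ℕ → Fin n → FreeWord n
tuple n m i = word n (Vec.lookup (decodeVec n m) i)

tuple-surjective : ∀ {n} (ws : Fin n → FreeWord n) → ∃ λ m → ∀ i → tuple n m i ≡ ws i
tuple-surjective {n} ws
  with m , eq ← decodeVec-surjective (Vec.tabulate (proj₁ ∘ word-surjective ∘ ws)) =
  m , λ i → ≡.trans (≡.cong (word n) (≡.trans (≡.cong (λ xs → Vec.lookup xs i) eq)
                                   (Vecₚ.lookup∘tabulate (proj₁ ∘ word-surjective ∘ ws) i)))
                    (proj₂ (word-surjective (ws i)))

-- Words acting trivially on small sets

invLetter : ∀ {n} → Letter n → Letter n
invLetter (i , b) = i , not b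

invWord : ∀ {n} → FreeWord n → FreeWord n
invWord []      = []
invWord (l ∷ w) = invWord w ++ [ invLetter l ]

-- One self-map of a `d`-element set per generator, as finite data so that all tables can be listed.
Table : ℕ → ℕ → Set
Table n d = Vec (Vec (Fin d) d) n

module Action {n d : ℕ} (α β : Table n d) where

  actLetter : Letter n → Fin d → Fin d
  actLetter (i , true)  x = Vec.lookup (Vec.lookup α i) x
  actLetter (i , false) x = Vec.lookup (Vec.lookup β i) x

  act : FreeWord n → Fin d → Fin d
  act []      x = x
  act (l ∷ w) x = actLetter l (act w x)

  Inverse : Set
  Inverse = ∀ i x → (actLetter (i , true) (actLetter (i , false) x) ≡ x) ×
                    (actLetter (i , false) (actLetter (i , true) x) ≡ x)

  inverse? : Dec Inverse
  inverse? = all? λ i → all? λ x → (_ Fin.≟ x) ×-dec (_ Fin.≟ x)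

  act-++ : ∀ u v x → act (u ++ v) x ≡ act u (act v x)
  act-++ []      v x = ≡.refl
  act-++ (l ∷ u) v x = ≡.cong (actLetter l) (act-++ u v x)

  actLetter-inv : Inverse → ∀ l x → actLetter l (actLetter (invLetter l) x) ≡ x
  actLetter-inv inverse (i , true)  x = proj₁ (inverse i x)
  actLetter-inv inverse (i , false) x = proj₂ (inverse i x)

  act-inv : Inverse → ∀ w x → act w (act (invWord w) x) ≡ x
  act-inv inverse []      x = ≡.refl
  act-inv inverse (l ∷ w) x =
    ≡.trans (≡.cong (actLetter l ∘ act w) (act-++ (invWord w) [ invLetter l ] x))
            (≡.trans (≡.cong (actLetter l) (act-inv inverse w _)) (actLetter-inv inverse l x))

tables : {A : Set} → List A → (n : ℕ) → List (Vec A n)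
tables xs zero    = [ [] ]
tables xs (suc n) = List.cartesianProductWith _∷_ xs (tables xs n)

∈-tables : {A : Set} {xs : List A} → (∀ x → x ∈ xs) → ∀ {n} (v : Vec A n) → v ∈ tables xs n
∈-tables all []      = here ≡.refl
∈-tables all (x ∷ v) = ∈-cartesianProductWith⁺ _∷_ (all x) (∈-tables all v)

allTables : (n d : ℕ) → List (Table n d)
allTables n d = tables (tables (List.allFin d) d) n

∈-allTables : ∀ {n d} (α : Table n d) → α ∈ allTables n d
∈-allTables = ∈-tables (∈-tables ∈-allFin)

module _ (n c : ℕ) where

  Observation : Set
  Observation = Σ (Fin (suc c)) λ k → Table n (toℕ k) × Table n (toℕ k) × Fin (toℕ k)

  -- Tables that are not inverse to each other yield the constant observation zero.
  observe : Observation → FreeWord n → Fin (suc c)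
  observe (k , α , β , x) w with Action.inverse? α β
  ... | yes _ = inject≤ (Action.act α β w x) (ℕ.<⇒≤ (toℕ<n k))
  ... | no  _ = zero

  observations : List Observation
  observations = List.concatMap (λ k → List.map (k ,_) (List.cartesianProduct (allTables n (toℕ k))
                   (List.cartesianProduct (allTables n (toℕ k)) (List.allFin (toℕ k)))))
                 (List.allFin (suc c))

  ∈-observations : ∀ o → o ∈ observations
  ∈-observations (k , α , β , x) = ∈-concatMap⁺ _ (Any.map (λ { ≡.refl →
      ∈-map⁺ (k ,_) (∈-cartesianProductWith⁺ _,_ (∈-allTables α)
        (∈-cartesianProductWith⁺ _,_ (∈-allTables β) (∈-allFin x))) })
    (∈-allFin k))

  -- Packing the observations into one element of a finite set makes agreement on them decidable,
  -- with finitely many classes.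
  profile : (os : List Observation) → FreeWord n → Fin (suc c ^ List.length os)
  profile []       w = zero
  profile (o ∷ os) w = combine (observe o w) (profile os w)

  profile-injective : ∀ os v w {o} → profile os v ≡ profile os w → o ∈ os → observe o v ≡ observe o w
  profile-injective (o ∷ os) v w eq o∈
    with eq₁ , eq₂ ← combine-injective (observe o v) (profile os v) (observe o w) (profile os w) eq
    with o∈
  ... | here ≡.refl = eq₁
  ... | there o∈′ = profile-injective os v w eq₂ o∈′

  profile-cong : ∀ os {v w} → (∀ o → observe o v ≡ observe o w) → profile os v ≡ profile os w
  profile-cong []       eq = ≡.refl
  profile-cong (o ∷ os) eq = ≡.cong₂ combine (eq o) (profile-cong os eq)

  -- These words act trivially on every set of at most c elements, and have finite index.
  Trivial : FreeWord n → Set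
  Trivial q = profile observations q ≡ profile observations []

  trivial? : ∀ q → Dec (Trivial q)
  trivial? q = profile observations q Fin.≟ profile observations []

  trivial-acts : ∀ {q} → Trivial q → (k : Fin (suc c)) (α β : Table n (toℕ k)) →
                 Action.Inverse α β → ∀ x → Action.act α β q x ≡ x
  trivial-acts {q} eq k α β inverse x
    with same ← profile-injective observations q [] eq (∈-observations (k , α , β , x))
    with Action.inverse? α β
  ... | yes _        = inject≤-injective _ _ _ _ same
  ... | no  ¬inverse = ⊥-elim (¬inverse inverse)

  -- Agreement of `v` and `w` at the point v⁻¹ x gives w v⁻¹ x = v v⁻¹ x = x.
  trivial-quotient : ∀ v w → profile observations v ≡ profile observations w →
                     Trivial (w ++ invWord v)
  trivial-quotient v w eq = profile-cong observations agree
    where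
    agree : ∀ o → observe o (w ++ invWord v) ≡ observe o []
    agree (k , α , β , x)
      with same ← profile-injective observations v w eq
                    (∈-observations (k , α , β , Action.act α β (invWord v) x))
      with Action.inverse? α β
    ... | no  _       = ≡.refl
    ... | yes inverse = ≡.cong (λ y → inject≤ y (ℕ.<⇒≤ (toℕ<n k)))
      (≡.trans (act-++ w (invWord v) x)
        (≡.trans (≡.sym (inject≤-injective _ _ _ _ same)) (act-inv inverse v x)))
      where open Action α β

-- Values of words, and congruences on the group

module Evaluation {c ℓ : Level} (G : Group c ℓ) where

  open Group G
  open Algebra.Properties.Group G
  open import Relation.Binary.Reasoning.Setoid setoid

  letterValue : {n : ℕ} → (Fin n → Carrier) → Letter n → Carrier
  letterValue s (i , true)  = s i
  letterValue s (i , false) = s i ⁻¹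

  value : {n : ℕ} → (Fin n → Carrier) → FreeWord n → Carrier
  value s []      = ε
  value s (l ∷ w) = letterValue s l ∙ value s w

  value-++ : {n : ℕ} (s : Fin n → Carrier) (u v : FreeWord n) →
             value s (u ++ v) ≈ value s u ∙ value s v
  value-++ s []      v = sym (identityˡ _)
  value-++ s (l ∷ u) v = trans (∙-congˡ (value-++ s u v)) (sym (assoc _ _ _))

  letterValue-inv : {n : ℕ} (s : Fin n → Carrier) (l : Letter n) →
                    letterValue s (invLetter l) ≈ letterValue s l ⁻¹
  letterValue-inv s (i , true)  = refl
  letterValue-inv s (i , false) = sym (⁻¹-involutive _)

  value-inv : {n : ℕ} (s : Fin n → Carrier) (w : FreeWord n) → value s (invWord w) ≈ value s w ⁻¹
  value-inv s []      = sym ε⁻¹≈ε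
  value-inv s (l ∷ w) = begin
    value s (invWord w ++ [ invLetter l ])           ≈⟨ value-++ s (invWord w) _ ⟩
    value s (invWord w) ∙ (letterValue s (invLetter l) ∙ ε)
      ≈⟨ ∙-cong (value-inv s w) (trans (identityʳ _) (letterValue-inv s l)) ⟩
    value s w ⁻¹ ∙ letterValue s l ⁻¹                ≈⟨ ⁻¹-anti-homo-∙ _ _ ⟨
    (letterValue s l ∙ value s w) ⁻¹                 ∎

  flatten : {n : ℕ} → Word G n → FreeWord n
  flatten (gen i)   = [ i , true ]
  flatten unit      = []
  flatten (inv w)   = invWord (flatten w)
  flatten (mul v w) = flatten v ++ flatten w

  value-flatten : {n : ℕ} (s : Fin n → Carrier) (w : Word G n) → value s (flatten w) ≈ eval G s w
  value-flatten s (gen i)   = identityʳ _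
  value-flatten s unit      = refl
  value-flatten s (inv w)   = trans (value-inv s (flatten w)) (⁻¹-cong (value-flatten s w))
  value-flatten s (mul v w) =
    trans (value-++ s (flatten v) _) (∙-cong (value-flatten s v) (value-flatten s w))

  record Congruence {r : Level} (R : Carrier → Carrier → Set r) : Set (c ⊔ ℓ ⊔ r) where
    field
      reflexive′ : ∀ {x y} → x ≈ y → R x y
      sym′       : ∀ {x y} → R x y → R y x
      trans′     : ∀ {x y z} → R x y → R y z → R x z
      ∙-cong′    : ∀ {x y u v} → R x y → R u v → R (x ∙ u) (y ∙ v)

    ∙-congʳ′ : ∀ {x y z} → R x y → R (x ∙ z) (y ∙ z)
    ∙-congʳ′ p = ∙-cong′ p (reflexive′ refl)

    ∙-congˡ′ : ∀ {x y z} → R x y → R (z ∙ x) (z ∙ y)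
    ∙-congˡ′ p = ∙-cong′ (reflexive′ refl) p

    move-rightʳ : ∀ {x y z} → R (x ∙ z ⁻¹) y → R x (y ∙ z)
    move-rightʳ p = trans′ (reflexive′ (sym (//-rightDividesˡ _ _))) (∙-congʳ′ p)

    move-rightˡ : ∀ {x y z} → R (x ∙ z) y → R x (y ∙ z ⁻¹)
    move-rightˡ p = trans′ (reflexive′ (sym (//-rightDividesʳ _ _))) (∙-congʳ′ p)

    move-leftʳ : ∀ {x y z} → R (z ∙ x) y → R x (z ⁻¹ ∙ y)
    move-leftʳ p = trans′ (reflexive′ (sym (\\-leftDividesʳ _ _))) (∙-congˡ′ p)

  ≈-congruence : Congruence _≈_
  ≈-congruence = record { reflexive′ = id ; sym′ = sym ; trans′ = trans ; ∙-cong′ = ∙-cong }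

  -- The congruence of the quotient by K; once `B` is given, it collapses to `≈`.
  Under : {b : Level} → Set b → Carrier → Carrier → Set (b ⊔ ℓ)
  Under B x y = B → x ≈ y

  under-congruence : {b : Level} (B : Set b) → Congruence (Under B)
  under-congruence B = record
    { reflexive′ = λ p _ → p
    ; sym′       = λ p b → sym (p b)
    ; trans′     = λ p q b → trans (p b) (q b)
    ; ∙-cong′    = λ p q b → ∙-cong (p b) (q b)
    }

-- Canonical words for a congruence

coverSize : ℕ → ℕ
coverSize zero    = 0
coverSize (suc k) = 2 + (coverSize k + (coverSize k + coverSize k))

module Choices {c ℓ : Level} (G : Group c ℓ) {n : ℕ} (s : Fin n → Group.Carrier G) (C : ℕ) where

  open Group G
  open Evaluation G

  ⟦_⟧ : FreeWord n → Carrier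
  ⟦_⟧ = value s

  -- A `keeping v` stage chooses an element that is to stay, `v` times a trivial word; a
  -- `dropping r` stage chooses a coset in which one element x is to be dropped, along with x ∙ r.
  -- Stages are treated from the end of a vector, each head after its tail.
  data Stage : Set c where
    keeping  : FreeWord n → Stage
    dropping : Carrier → Stage

  prefix : Stage → FreeWord n
  prefix (keeping v)  = v
  prefix (dropping _) = []

  multiplier : Stage → Carrier
  multiplier (keeping _)  = ε
  multiplier (dropping r) = r

  el : Stage → ℕ → Carrier
  el σ u = ⟦ prefix σ ⟧ ∙ ⟦ word n u ⟧

  module _ (R : Carrier → Carrier → Set ℓ) where

    -- Each stage protects the chosen element and its product with the multiplier.  The last two
    -- constructors account for what the same stage may choose for a finer congruence: by
    -- minimality either of its two elements may then fall into an earlier coset.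
    data Covered : {k : ℕ} → Vec Stage k → Vec ℕ k → Carrier → Set (c ⊔ ℓ) where
      first  : ∀ {k} {σs : Vec Stage k} {gs σ g x} → R x (el σ g) → Covered (σ ∷ σs) (g ∷ gs) x
      second : ∀ {k} {σs : Vec Stage k} {gs σ g x} → R x (el σ g ∙ multiplier σ) →
               Covered (σ ∷ σs) (g ∷ gs) x
      later  : ∀ {k} {σs : Vec Stage k} {gs σ g x} → Covered σs gs x → Covered (σ ∷ σs) (g ∷ gs) x
      later⁻ : ∀ {k} {σs : Vec Stage k} {gs σ g x} → Covered σs gs (x ∙ multiplier σ ⁻¹) →
               Covered (σ ∷ σs) (g ∷ gs) x
      later⁺ : ∀ {k} {σs : Vec Stage k} {gs σ g x} → Covered σs gs (x ∙ multiplier σ) →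
               Covered (σ ∷ σs) (g ∷ gs) x

    data Stale {k : ℕ} (σs : Vec Stage k) (gs : Vec ℕ k) (σ : Stage) (u : ℕ) : Set (c ⊔ ℓ) where
      stale₁ : Covered σs gs (el σ u) → Stale σs gs σ u
      stale₂ : Covered σs gs (el σ u ∙ multiplier σ) → Stale σs gs σ u

    record Lowest {k : ℕ} (σs : Vec Stage k) (gs : Vec ℕ k) (σ : Stage) (g : ℕ) : Set (c ⊔ ℓ) where
      constructor lowest
      field
        member : Trivial n C (word n g)
        below  : ∀ u → u < g → Trivial n C (word n u) → Stale σs gs σ u

    data Minimal : {k : ℕ} → Vec Stage k → Vec ℕ k → Set (c ⊔ ℓ) where
      []  : Minimal [] []
      _∷_ : ∀ {k} {σs : Vec Stage k} {gs σ g} →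
            Lowest σs gs σ g → Minimal σs gs → Minimal (σ ∷ σs) (g ∷ gs)

    -- Kept apart from `Minimal` because the two vary in opposite directions: minimality passes to
    -- coarser congruences, freshness to finer ones.
    data Fresh (B : Set ℓ) : {k : ℕ} → Vec Stage k → Vec ℕ k → Set (c ⊔ ℓ) where
      []  : Fresh B [] []
      _∷_ : ∀ {k} {σs : Vec Stage k} {gs σ g} →
            (Stale σs gs σ g → B) → Fresh B σs gs → Fresh B (σ ∷ σs) (g ∷ gs)

  data At : {k : ℕ} → Vec Stage k → Vec ℕ k → Stage → ℕ → Set c where
    here  : ∀ {k} {σs : Vec Stage k} {gs σ g} → At (σ ∷ σs) (g ∷ gs) σ g
    there : ∀ {k} {σs : Vec Stage k} {gs σ g σ′ g′} → At σs gs σ g → At (σ′ ∷ σs) (g′ ∷ gs) σ g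

  module _ {R R′ : Carrier → Carrier → Set ℓ} (f : ∀ {x y} → R x y → R′ x y) where

    covered-map : ∀ {k} {σs : Vec Stage k} {gs x} → Covered R σs gs x → Covered R′ σs gs x
    covered-map (first p)  = first (f p)
    covered-map (second p) = second (f p)
    covered-map (later q)  = later (covered-map q)
    covered-map (later⁻ q) = later⁻ (covered-map q)
    covered-map (later⁺ q) = later⁺ (covered-map q)

    stale-map : ∀ {k} {σs : Vec Stage k} {gs σ u} → Stale R σs gs σ u → Stale R′ σs gs σ u
    stale-map (stale₁ q) = stale₁ (covered-map q)
    stale-map (stale₂ q) = stale₂ (covered-map q)

    minimal-map : ∀ {k} {σs : Vec Stage k} {gs} → Minimal R σs gs → Minimal R′ σs gs
    minimal-map []                = []
    minimal-map (lowest g∈ below ∷ ms) =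
      lowest g∈ (λ u u<g u∈ → stale-map (below u u<g u∈)) ∷ minimal-map ms

  fresh-map : ∀ {R R′ : Carrier → Carrier → Set ℓ} {B B′ : Set ℓ} →
              (∀ {x y} → R′ x y → R x y) → (B → B′) →
              ∀ {k} {σs : Vec Stage k} {gs} → Fresh R B σs gs → Fresh R′ B′ σs gs
  fresh-map f g []       = []
  fresh-map f g (h ∷ hs) =
    g ∘ h ∘ stale-map f ∷ fresh-map f g hs

  -- Comparison of two choices

  module Comparison {R : Carrier → Carrier → Set ℓ} (cong : Congruence R) where

    open Congruence cong

    covered-resp : ∀ {k} {σs : Vec Stage k} {gs x y} → R x y → Covered R σs gs y → Covered R σs gs x
    covered-resp e (first p)  = first (trans′ e p)
    covered-resp e (second p) = second (trans′ e p)
    covered-resp e (later q)  = later (covered-resp e q)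
    covered-resp e (later⁻ q) = later⁻ (covered-resp (∙-congʳ′ e) q)
    covered-resp e (later⁺ q) = later⁺ (covered-resp (∙-congʳ′ e) q)

    stale⇒covered : ∀ {k} {σs : Vec Stage k} {gs σ u g} → Stale R σs gs σ u →
                    Covered R (σ ∷ σs) (g ∷ gs) (el σ u)
    stale⇒covered (stale₁ q) = later q
    stale⇒covered (stale₂ q) = later⁺ q

    stale⇒covered′ : ∀ {k} {σs : Vec Stage k} {gs σ u g} → Stale R σs gs σ u →
                     Covered R (σ ∷ σs) (g ∷ gs) (el σ u ∙ multiplier σ)
    stale⇒covered′ (stale₁ q) =
      later⁻ (covered-resp (sym′ (move-rightˡ (reflexive′ refl))) q)
    stale⇒covered′ (stale₂ q) = later q

    mutual
      -- Freshness is asked of `gs′` alone, so that `gs` may be a choice for a finer congruence,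
      -- carried over by `minimal-map`.
      transfer : ∀ {B : Set ℓ} {k} {σs : Vec Stage k} {gs gs′} → Minimal R σs gs → Minimal R σs gs′ →
                 Fresh R B σs gs′ → ∀ {x} → Covered R σs gs x → B ⊎ Covered R σs gs′ x
      transfer (m ∷ ms) (m′ ∷ ms′) (f ∷ fs) (first e)
        with transfer-head m ms m′ ms′ f fs
      ... | inj₁ b                 = inj₁ b
      ... | inj₂ (inj₁ ≡.refl)     = inj₂ (first e)
      ... | inj₂ (inj₂ stale)      = inj₂ (covered-resp e (stale⇒covered stale))
      transfer (m ∷ ms) (m′ ∷ ms′) (f ∷ fs) (second e)
        with transfer-head m ms m′ ms′ f fs
      ... | inj₁ b                 = inj₁ b
      ... | inj₂ (inj₁ ≡.refl)     = inj₂ (second e)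
      ... | inj₂ (inj₂ stale)      = inj₂ (covered-resp e (stale⇒covered′ stale))
      transfer (_ ∷ ms) (_ ∷ ms′) (_ ∷ fs) (later q)  = Sum.map id later (transfer ms ms′ fs q)
      transfer (_ ∷ ms) (_ ∷ ms′) (_ ∷ fs) (later⁻ q) = Sum.map id later⁻ (transfer ms ms′ fs q)
      transfer (_ ∷ ms) (_ ∷ ms′) (_ ∷ fs) (later⁺ q) = Sum.map id later⁺ (transfer ms ms′ fs q)

      -- If `g` is smaller, minimality of `g′` makes it stale for `gs′`. If `g′` is smaller, it is
      -- stale for `gs`, hence by `transfer` for `gs′`, against its freshness.
      transfer-head : ∀ {B : Set ℓ} {k} {σs : Vec Stage k} {σ g gs g′ gs′} →
        Lowest R σs gs σ g → Minimal R σs gs → Lowest R σs gs′ σ g′ → Minimal R σs gs′ →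
        (Stale R σs gs′ σ g′ → B) → Fresh R B σs gs′ →
        B ⊎ (g ≡ g′ ⊎ Stale R σs gs′ σ g)
      transfer-head {g = g} {g′ = g′} (lowest g∈ below) ms (lowest g′∈ below′) ms′ f fs with ℕ.<-cmp g g′
      ... | tri< g<g′ _ _ = inj₂ (inj₂ (below′ g g<g′ g∈))
      ... | tri≈ _ g≡g′ _ = inj₂ (inj₁ g≡g′)
      ... | tri> _ _ g′<g with below g′ g′<g g′∈
      ...   | stale₁ q = inj₁ ([ id , f ∘ stale₁ ]′ (transfer ms ms′ fs q))
      ...   | stale₂ q = inj₁ ([ id , f ∘ stale₂ ]′ (transfer ms ms′ fs q))

    choice-unique : ∀ {B : Set ℓ} {k} {σs : Vec Stage k} {gs gs′} →
                    Minimal R σs gs → Fresh R B σs gs → Minimal R σs gs′ → Fresh R B σs gs′ →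
                    B ⊎ gs ≡ gs′
    choice-unique [] [] [] [] = inj₂ ≡.refl
    choice-unique {gs = g ∷ _} {g′ ∷ _} (lowest g∈ below ∷ ms) (f ∷ fs) (lowest g′∈ below′ ∷ ms′) (f′ ∷ fs′)
      with choice-unique ms fs ms′ fs′
    ... | inj₁ b      = inj₁ b
    ... | inj₂ ≡.refl with ℕ.<-cmp g g′
    ...   | tri< g<g′ _ _    = inj₁ (f (below′ g g<g′ g∈))
    ...   | tri≈ _ ≡.refl _  = inj₂ ≡.refl
    ...   | tri> _ _ g′<g    = inj₁ (f′ (below g′ g′<g g′∈))

    data Near (σ : Stage) (g : ℕ) (x : Carrier) : Set ℓ where
      near₁ : R x (el σ g) → Near σ g x
      near₂ : R x (el σ g ∙ multiplier σ) → Near σ g x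

    near⇒covered : ∀ {k} {σs : Vec Stage k} {gs σ g x} → At σs gs σ g → Near σ g x → Covered R σs gs x
    near⇒covered here       (near₁ e) = first e
    near⇒covered here       (near₂ e) = second e
    near⇒covered (there at) e        = later (near⇒covered at e)

    near-stale : ∀ {k} {σs : Vec Stage k} {gs σ g x} → Near σ g x → Covered R σs gs x →
                 Stale R σs gs σ g
    near-stale (near₁ e) q = stale₁ (covered-resp (sym′ e) q)
    near-stale (near₂ e) q = stale₂ (covered-resp (sym′ e) q)

    at-unique : ∀ {B : Set ℓ} {k} {σs : Vec Stage k} {gs σ g σ′ g′ x} → Fresh R B σs gs →
                At σs gs σ g → Near σ g x → At σs gs σ′ g′ → Near σ′ g′ x →
                B ⊎ (σ , g) ≡ (σ′ , g′)
    at-unique _        here       _ here        _  = inj₂ ≡.refl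
    at-unique (f ∷ _)  here       e (there at′) e′ = inj₁ (f (near-stale e (near⇒covered at′ e′)))
    at-unique (f ∷ _)  (there at) e here        e′ = inj₁ (f (near-stale e′ (near⇒covered at e)))
    at-unique (_ ∷ fs) (there at) e (there at′) e′ = at-unique fs at e at′ e′

  elements : {k : ℕ} → Vec Stage k → Vec ℕ k → List Carrier
  elements []       []       = []
  elements (σ ∷ σs) (g ∷ gs) =
    el σ g ∷ el σ g ∙ multiplier σ ∷ (elements σs gs ++
      (List.map (_∙ multiplier σ) (elements σs gs) ++ List.map (_∙ multiplier σ ⁻¹) (elements σs gs)))

  length-elements : ∀ {k} (σs : Vec Stage k) gs → List.length (elements σs gs) ≡ coverSize k
  length-elements []       []       = ≡.refl
  length-elements (σ ∷ σs) (g ∷ gs) = ≡.cong (2 +_)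
    (≡.trans (Listₚ.length-++ (elements σs gs)) (≡.cong₂ _+_ ih
      (≡.trans (Listₚ.length-++ (List.map (_∙ multiplier σ) (elements σs gs))) (≡.cong₂ _+_
        (≡.trans (Listₚ.length-map _ (elements σs gs)) ih)
        (≡.trans (Listₚ.length-map _ (elements σs gs)) ih)))))
    where ih = length-elements σs gs

  module _ {R : Carrier → Carrier → Set ℓ} (cong : Congruence R) where

    open Congruence cong

    covered⇒any : ∀ {k} {σs : Vec Stage k} {gs x} → Covered R σs gs x → Any (R x) (elements σs gs)
    covered⇒any (first e)  = here e
    covered⇒any (second e) = there (here e)
    covered⇒any (later q)  = there (there (Anyₚ.++⁺ˡ (covered⇒any q)))
    covered⇒any {σs = σ ∷ σs} {_ ∷ gs} (later⁻ q) = there (there (Anyₚ.++⁺ʳ (elements σs gs)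
      (Anyₚ.++⁺ˡ (Anyₚ.map⁺ (Any.map move-rightʳ (covered⇒any q))))))
    covered⇒any {σs = σ ∷ σs} {_ ∷ gs} (later⁺ q) = there (there (Anyₚ.++⁺ʳ (elements σs gs)
      (Anyₚ.++⁺ʳ (List.map (_∙ multiplier σ) (elements σs gs))
        (Anyₚ.map⁺ (Any.map move-rightˡ (covered⇒any q))))))

  -- Existence of canonical words

  module Existence (generates : ∀ g → ∃ λ w → ⟦ w ⟧ ≈ g) (B : Set ℓ)
                   {R : Carrier → Carrier → Set ℓ} (cong : Congruence R)
                   (unbounded : ∀ l → (∀ g → Relative.Cont B (Any (R g) l)) → B) where

    open Relative B
    open Congruence cong

    -- Trivial words have finite index. If all of them led into `l`, the finitely many products p⁻¹
    -- z v, with p the prefix, z in `l` and v representing a profile, would exhaust the group modulo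
    -- `R`.
    avoiding : ∀ σ (l : List Carrier) →
               Cont (∃ λ u → Trivial n C (word n u) × (Any (R (el σ u)) l → B))
    avoiding σ l none = representatives [] (profile n C (observations n C)) λ (vs , represent) →
      unbounded (List.cartesianProductWith (λ z v → (⟦ prefix σ ⟧ ⁻¹ ∙ z) ∙ ⟦ v ⟧) l vs) λ g k →
      let w , w≈g = generates g in
      represent w λ v∈vs →
      let v , v∈ , same = find v∈vs
          u , eq        = word-surjective (w ++ invWord v)
          el≈           : el σ u ≈ ⟦ prefix σ ⟧ ∙ (g ∙ ⟦ v ⟧ ⁻¹)
          el≈           = ∙-congˡ (trans (reflexive (≡.cong ⟦_⟧ eq))
                            (trans (value-++ s w (invWord v)) (∙-cong w≈g (value-inv s v))))
      in none (u , ≡.subst (Trivial n C) (≡.sym eq) (trivial-quotient n C v w same) , λ any →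
        k (Anyₚ.cartesianProductWith⁺ _
             (λ p v≡ → trans′ (move-rightʳ (move-leftʳ (trans′ (reflexive′ (sym el≈)) p)))
                              (reflexive′ (∙-congˡ (reflexive (≡.cong ⟦_⟧ v≡))))) any v∈))

    choose : ∀ {k} (σs : Vec Stage k) → Cont (∃ λ gs → Minimal R σs gs × Fresh R B σs gs)
    choose []       = return ([] , [] , [])
    choose (σ ∷ σs) = choose σs >>= λ (gs , ms , fs) →
      let l = elements σs gs
          stale⇒any : ∀ {u} → Stale R σs gs σ u →
                      Any (R (el σ u)) (l ++ List.map (_∙ multiplier σ ⁻¹) l)
          stale⇒any = λ { (stale₁ q) → Anyₚ.++⁺ˡ (covered⇒any cong q)
                        ; (stale₂ q) → Anyₚ.++⁺ʳ l (Anyₚ.map⁺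
                            (Any.map move-rightˡ (covered⇒any cong q))) }
          test : ∀ u → Cont ((Trivial n C (word n u) × (Stale R σs gs σ u → B)) ⊎
                             (Trivial n C (word n u) → Stale R σs gs σ u))
          test u = decide (Stale R σs gs σ u) >>= λ where
            (inj₁ stale) → return (inj₂ λ _ → stale)
            (inj₂ fresh) → return (case trivial? n C (word n u) of λ where
              (yes t) → inj₁ (t , fresh)
              (no ¬t) → inj₂ (⊥-elim ∘ ¬t))
      -- The translates by the inverse multiplier make the second element of the stage avoid `l`
      -- too.
      in avoiding σ (l ++ List.map (_∙ multiplier σ ⁻¹) l) >>= λ (u , t , avoids) →
         least test u (t , avoids ∘ stale⇒any) >>= λ (g , (t′ , fresh) , below) →
         return (g ∷ gs , lowest t′ below ∷ ms , fresh ∷ fs)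

-- Stages, and the elements dropped at a proposition

module Colouring {c ℓ : Level} (G : Group c ℓ) {n : ℕ} (s : Fin n → Group.Carrier G)
                 (generates : ∀ g → ∃ λ (w : FreeWord n) →
                   Group._≈_ G (Evaluation.value G s w) g)
                 (infinite : Infinite G) where

  open Group G
  open Algebra.Properties.Group G
  open Evaluation G

  enumerated⇒finite : (l : List Carrier) → (∀ g → Any (g ≈_) l) → Finite G
  enumerated⇒finite l cover = List.length l , List.lookup l , λ g →
    Any.index (cover g) , sym (Anyₚ.lookup-index (cover g))

  module _ (B : Set ℓ) {R : Carrier → Carrier → Set ℓ} (cong : Congruence R)
           (finite⇒B : ∀ l → (∀ g → Any (R g) l) → B) where

    open Relative B
    open Congruence cong

    -- A list covering G up to B may be assumed to be closed under the generators; then it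
    -- covers every word outright.
    unbounded : ∀ l → (∀ g → Cont (Any (R g) l)) → B
    unbounded l cover =
      collectAll l (λ {z} _ → collectFin λ i → cover (s i ∙ z) >>= λ p →
        cover (s i ⁻¹ ∙ z) >>= λ q → return (p , q)) λ closed →
      cover ε λ unit∈ →
      finite⇒B l λ g → let w , w≈g = generates g in
        Any.map (trans′ (reflexive′ (sym w≈g))) (all closed unit∈ w)
      where
      all : All (λ z → ∀ i → Any (R (s i ∙ z)) l × Any (R (s i ⁻¹ ∙ z)) l) l → Any (R ε) l →
            ∀ w → Any (R (value s w)) l
      all closed unit∈ []      = unit∈
      all closed unit∈ ((i , b) ∷ w)
        with z , z∈ , p ← find (all closed unit∈ w)
        with p⁺ , p⁻ ← All.lookup closed z∈ i
        with b
      ... | true  = Any.map (trans′ (∙-congˡ′ p)) p⁺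
      ... | false = Any.map (trans′ (∙-congˡ′ p)) p⁻

  -- The empty word provides a head stage, from which injectivity of `φ` is derived; the generators
  -- are the words to be fixed.
  keepingWords : Vec (FreeWord n) (suc n)
  keepingWords = [] ∷ Vec.map (λ i → [ i , true ]) (Vec.allFin n)

  stageCount : ℕ
  stageCount = suc n + (n + n * n)

  -- A choice protects the cosets of `coverSize stageCount` listed elements. The number is doubled
  -- because both x and x ∙ r must avoid them.
  C : ℕ
  C = coverSize stageCount + coverSize stageCount

  open Choices G s C

  droppingStages : Vec Stage (n + n * n)
  droppingStages = Vec.map (dropping ∘ s) (Vec.allFin n) Vec.++
    Vec.map (λ p → dropping (s (proj₁ p) ∙ s (proj₂ p))) (Vec.allPairs (Vec.allFin n) (Vec.allFin n))

  stages : Vec Stage stageCount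
  stages = Vec.map keeping keepingWords Vec.++ droppingStages

  Choice : Set
  Choice = Vec ℕ stageCount

  pt : ℕ → Carrier
  pt u = ⟦ word n u ⟧

  Big : Set ℓ → Set (c ⊔ ℓ)
  Big B = Σ (List Carrier) λ ks →
    C < List.length ks × All (λ k → Under B k ε) ks × AllPairs (λ j k → j ≈ k → B) ks

  record Candidate (B : Set ℓ) (gs : Choice) (e r : Carrier) (a : ℕ) : Set (c ⊔ ℓ) where
    field
      near       : Under B (pt a) e
      uncovered  : Covered _≈_ stages gs (pt a) → B
      uncovered′ : Covered _≈_ stages gs (pt a ∙ r) → B

  -- If K is small, the coset of a kept element loses everything else. If K is big, only `pt a` and
  -- `pt a ∙ r` go, with `a` least so that they are determined.
  data Pattern (B : Set ℓ) (gs : Choice) (g : ℕ) (x : Carrier) : Stage → Set (c ⊔ ℓ) where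
    small : ∀ {v} → (Big B → B) → Under B x (el (keeping v) g) → (x ≈ el (keeping v) g → B) →
            Pattern B gs g x (keeping v)
    large : ∀ {r} → Big B → (Under B r ε → B) → (a : ℕ) →
            Candidate B gs (el (dropping r) g) r a →
            (∀ a′ → a′ < a → Candidate B gs (el (dropping r) g) r a′ → B) →
            x ≈ pt a ⊎ x ≈ pt a ∙ r → Pattern B gs g x (dropping r)

  -- `gs⁺` is the choice modulo K, which locates the dropped elements, and `gs` the choice for `≈`,
  -- whose covered elements are exempt. Both are unique up to `B` by `choice-unique`, so quantifying
  -- over them adds no freedom.
  record Dropped (B : Set ℓ) (x : Carrier) : Set (c ⊔ ℓ) where
    field
      gs⁺ gs    : Choice
      minimal⁺  : Minimal (Under B) stages gs⁺
      fresh⁺    : Fresh (Under B) B stages gs⁺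
      minimal   : Minimal _≈_ stages gs
      fresh     : Fresh _≈_ B stages gs
      {σ}       : Stage
      {g}       : ℕ
      at        : At stages gs⁺ σ g
      pattern′  : Pattern B gs g x σ
      uncovered : Covered _≈_ stages gs x → B

  dropped-resp : ∀ {B x y} → x ≈ y → Dropped B x → Dropped B y
  dropped-resp {B} {x} {y} x≈y d = record
    { minimal⁺ = minimal⁺ ; fresh⁺ = fresh⁺ ; minimal = minimal ; fresh = fresh ; at = at
    ; pattern′ = go pattern′
    ; uncovered = uncovered ∘ Comparison.covered-resp ≈-congruence x≈y
    }
    where
    open Dropped d
    go : ∀ {σ} → Pattern B gs g x σ → Pattern B gs g y σ
    go (small ¬big near other)   = small ¬big (λ b → trans (sym x≈y) (near b)) (other ∘ trans x≈y)
    go (large big r≉ a cand low e) =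
      large big r≉ a cand low (Sum.map (trans (sym x≈y)) (trans (sym x≈y)) e)

  dropped-near : ∀ {B x} (d : Dropped B x) →
                 Comparison.Near (under-congruence B) (Dropped.σ d) (Dropped.g d) x
  dropped-near {B} {x} d = go (Dropped.pattern′ d)
    where
    open Comparison (under-congruence B)
    go : ∀ {σ} → Pattern B (Dropped.gs d) (Dropped.g d) x σ → Near σ (Dropped.g d) x
    go (small _ near _)                  = near₁ near
    go (large _ _ _ cand _ (inj₁ e)) = near₁ λ b → trans e (Candidate.near cand b)
    go (large _ _ _ cand _ (inj₂ e)) = near₂ λ b → trans e (∙-congʳ (Candidate.near cand b))

  module _ {B B′ : Set ℓ} (f : B → B′) (f⁻ : B′ → B) where

    big-map : Big B → Big B′
    big-map (ks , C< , near , distinct) =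
      ks , C< , All.map (_∘ f⁻) near , AllPairs.map (f ∘_) distinct

    candidate-map : ∀ {gs e r a} → Candidate B gs e r a → Candidate B′ gs e r a
    candidate-map cand = record
      { near = near ∘ f⁻ ; uncovered = f ∘ uncovered ; uncovered′ = f ∘ uncovered′ }
      where open Candidate cand

  -- Different tuples may yield equivalent propositions, and these must drop the same elements.
  dropped-map : ∀ {B B′ x} → (B → B′) → (B′ → B) → Dropped B x → Dropped B′ x
  dropped-map {B} {B′} {x} f f⁻ d = record
    { minimal⁺ = minimal-map (_∘ f⁻) minimal⁺ ; fresh⁺ = fresh-map (_∘ f) f fresh⁺
    ; minimal = minimal ; fresh = fresh-map id f fresh ; at = at
    ; pattern′ = go pattern′ ; uncovered = f ∘ uncovered }
    where
    open Dropped d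
    go : ∀ {σ} → Pattern B gs g x σ → Pattern B′ gs g x σ
    go (small ¬big near other)     = small (f ∘ ¬big ∘ big-map f⁻ f) (near ∘ f⁻) (f ∘ other)
    go (large big r≉ a cand low e) = large (big-map f f⁻ big) (λ r≈ → f (r≉ (r≈ ∘ f))) a
      (candidate-map f f⁻ cand) (λ a′ a′<a → f ∘ low a′ a′<a ∘ candidate-map f⁻ f) e

  -- The greedy two-colouring of a classical argument

  substituted : ℕ → ℕ → Carrier
  substituted m u = value (λ i → ⟦ tuple n m i ⟧) (word n u)

  record Movable (m : ℕ) (D K : List Carrier) (u : ℕ) : Set (c ⊔ ℓ) where
    field
      moved : ¬ substituted m u ≈ pt u
      ∉D    : ¬ Any (pt u ≈_) D
      ∉K    : ¬ Any (pt u ≈_) K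

  -- Taking the least word makes the greedy run deterministic, hence `state-unique`.
  LeastMovable : ℕ → List Carrier → List Carrier → ℕ → Set (c ⊔ ℓ)
  LeastMovable m D K u = Movable m D K u × (∀ v → v < u → ¬ Movable m D K v)

  -- State l m D K: after the first m tuples have been treated, the elements of D are dropped and
  -- those of K, initially l, have been committed to stay.
  data State (l : List Carrier) : ℕ → List Carrier → List Carrier → Set (c ⊔ ℓ) where
    start : State l 0 [] l
    skip  : ∀ {m D K} → State l m D K → (∀ u → ¬ Movable m D K u) → State l (suc m) D K
    keep  : ∀ {m D K} → State l m D K → (u : ℕ) → LeastMovable m D K u →
            Any (substituted m u ≈_) D → State l (suc m) D (pt u ∷ K)
    drop  : ∀ {m D K} → State l m D K → (u : ℕ) → LeastMovable m D K u →
            ¬ Any (substituted m u ≈_) D → State l (suc m) (pt u ∷ D) (substituted m u ∷ K)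

  least-movable-unique : ∀ {m D K u v} → LeastMovable m D K u → LeastMovable m D K v → u ≡ v
  least-movable-unique {u = u} {v} (mu , lowu) (mv , lowv) with ℕ.<-cmp u v
  ... | tri< u<v _ _ = ⊥-elim (lowv u u<v mu)
  ... | tri≈ _ u≡v _ = u≡v
  ... | tri> _ _ v<u = ⊥-elim (lowu v v<u mv)

  state-unique : ∀ {l m D K D′ K′} → State l m D K → State l m D′ K′ → (D , K) ≡ (D′ , K′)
  state-unique start start = ≡.refl
  state-unique (skip st none) (skip st′ _) with ≡.refl ← state-unique st st′ = ≡.refl
  state-unique (skip st none) (keep st′ u (mv , _) _)
    with ≡.refl ← state-unique st st′ = ⊥-elim (none u mv)
  state-unique (skip st none) (drop st′ u (mv , _) _)
    with ≡.refl ← state-unique st st′ = ⊥-elim (none u mv)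
  state-unique (keep st u (mv , _) _) (skip st′ none)
    with ≡.refl ← state-unique st st′ = ⊥-elim (none u mv)
  state-unique (drop st u (mv , _) _) (skip st′ none)
    with ≡.refl ← state-unique st st′ = ⊥-elim (none u mv)
  state-unique (keep st u least _) (keep st′ v least′ _)
    with ≡.refl ← state-unique st st′
    with ≡.refl ← least-movable-unique least least′ = ≡.refl
  state-unique (drop st u least _) (drop st′ v least′ _)
    with ≡.refl ← state-unique st st′
    with ≡.refl ← least-movable-unique least least′ = ≡.refl
  state-unique (keep st u least ∈D) (drop st′ v least′ ∉D)
    with ≡.refl ← state-unique st st′
    with ≡.refl ← least-movable-unique least least′ = ⊥-elim (∉D ∈D)
  state-unique (drop st u least ∉D) (keep st′ v least′ ∈D)
    with ≡.refl ← state-unique st st′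
    with ≡.refl ← least-movable-unique least least′ = ⊥-elim (∉D ∈D)

  state-disjoint : ∀ {l m D K x} → State l m D K → Any (x ≈_) D → Any (x ≈_) K → ⊥
  state-disjoint start ()
  state-disjoint (skip st _) d k = state-disjoint st d k
  state-disjoint (keep st u (mv , _) _) d (here e)  =
    Movable.∉D mv (Any.map (trans (sym e)) d)
  state-disjoint (keep st u _ _) d (there k) = state-disjoint st d k
  state-disjoint (drop st u (mv , _) _) (here e) (here e′) = Movable.moved mv (trans (sym e′) e)
  state-disjoint (drop st u (mv , _) _) (here e) (there k) =
    Movable.∉K mv (Any.map (trans (sym e)) k)
  state-disjoint (drop st u _ ∉D) (there d) (here e) = ∉D (Any.map (trans (sym e)) d)
  state-disjoint (drop st u _ _) (there d) (there k) = state-disjoint st d k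

  state-base : ∀ {l m D K x} → State l m D K → Any (x ≈_) l → Any (x ≈_) K
  state-base start           p = p
  state-base (skip st _)     p = state-base st p
  state-base (keep st _ _ _) p = there (state-base st p)
  state-base (drop st _ _ _) p = there (state-base st p)

  record Restriction (l : List Carrier) (j : ℕ) (D K : List Carrier) : Set (c ⊔ ℓ) where
    field
      {D₀ K₀} : List Carrier
      state   : State l j D₀ K₀
      D₀⊆D    : ∀ {x} → Any (x ≈_) D₀ → Any (x ≈_) D
      K₀⊆K    : ∀ {x} → Any (x ≈_) K₀ → Any (x ≈_) K

  restrict : ∀ {l m j D K} → State l m D K → j ≤ m → Restriction l j D K
  restrict {m = m} {j} st j≤m with ℕ.m≤n⇒m<n∨m≡n j≤m
  ... | inj₂ ≡.refl = record { state = st ; D₀⊆D = id ; K₀⊆K = id }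
  restrict (skip st _)     _ | inj₁ (s≤s j≤m) = restrict st j≤m
  restrict (keep st _ _ _) _ | inj₁ (s≤s j≤m) =
    record { state = state ; D₀⊆D = D₀⊆D ; K₀⊆K = there ∘ K₀⊆K }
    where open Restriction (restrict st j≤m)
  restrict (drop st _ _ _) _ | inj₁ (s≤s j≤m) =
    record { state = state ; D₀⊆D = there ∘ D₀⊆D ; K₀⊆K = there ∘ K₀⊆K }
    where open Restriction (restrict st j≤m)

  -- Two runs from the same list are comparable: the longer one passes through the final state of
  -- the shorter.
  states-disjoint : ∀ {l m m′ D K D′ K′ x} → State l m D K → State l m′ D′ K′ →
                    Any (x ≈_) D → Any (x ≈_) K′ → ⊥
  states-disjoint {m = m} {m′} st st′ d k with ℕ.≤-total m m′
  ... | inj₁ m≤m′ with r ← restrict st′ m≤m′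
                  with ≡.refl ← state-unique st (Restriction.state r) =
    state-disjoint st′ (Restriction.D₀⊆D r d) k
  ... | inj₂ m′≤m with r ← restrict st m′≤m
                  with ≡.refl ← state-unique st′ (Restriction.state r) =
    state-disjoint st d (Restriction.K₀⊆K r k)

  state-exists : ∀ l m → ¬ ¬ ∃₂ (State l m)
  state-exists l zero    k = k (_ , _ , start)
  state-exists l (suc m) k = state-exists l m λ (D , K , st) →
    decide (∃ (Movable m D K)) λ where
      (inj₂ none)     → k (_ , _ , skip st λ u mv → none (u , mv))
      (inj₁ (u , mv)) → least (λ v → decide (Movable m D K v)) u mv λ (v , mv′ , low) →
        decide (Any (substituted m v ≈_) D) λ where
          (inj₁ ∈D) → k (_ , _ , keep st v (mv′ , low) ∈D)
          (inj₂ ∉D) → k (_ , _ , drop st v (mv′ , low) ∉D)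
    where open Relative ⊥

  -- The colouring

  Never : Set ℓ
  Never = Lift ℓ ⊥

  -- The run starts with the protected elements already committed, so it never drops one of them.
  record ClassicallyDropped (x : Carrier) : Set (c ⊔ ℓ) where
    field
      gs      : Choice
      minimal : Minimal _≈_ stages gs
      fresh   : Fresh _≈_ Never stages gs
      {m}     : ℕ
      {D K}   : List Carrier
      state   : State (elements stages gs) m D K
      ∈D      : Any (x ≈_) D

  Identity : ℕ → Set ℓ
  Identity m = ∀ i → ⟦ tuple n m i ⟧ ≈ s i

  -- For each `m`, not being dropped is read modulo `Identity m`. Admitting only propositions that
  -- are not false makes this clause hold, up to double negation, for every element that is not
  -- classically dropped.
  Coloured : Carrier → Set (c ⊔ ℓ)
  Coloured x = ¬ ClassicallyDropped x ×
               (∀ m → ¬ ¬ Identity m → Dropped (Identity m) x → Identity m)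

  colouring : TwoColoring G
  colouring = record
    { colour  = Coloured
    ; respect = λ x≈y (top , rest) →
        (λ d → top (record { ClassicallyDropped d
                           ; ∈D = Any.map (trans x≈y) (ClassicallyDropped.∈D d) })) ,
        (λ m ¬¬b d → rest m ¬¬b (dropped-resp (sym x≈y) d))
    }

  -- `transfer` moves the covering to whichever choice a dropping of `x` refers to, and there `x` is
  -- protected.
  covered⇒coloured : ∀ {gs x} → Minimal _≈_ stages gs → Covered _≈_ stages gs x → Coloured x
  covered⇒coloured {x = x} minimal cov = top , λ m _ d →
      [ id , Dropped.uncovered d ]′ (transfer minimal (Dropped.minimal d) (Dropped.fresh d) cov)
    where
    open Comparison ≈-congruence
    top : ¬ ClassicallyDropped x
    top d = case transfer minimal CD.minimal CD.fresh cov of λ where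
        (inj₁ (lift ()))
        (inj₂ cov′) → state-disjoint CD.state CD.∈D
                        (state-base CD.state (covered⇒any ≈-congruence cov′))
      where module CD = ClassicallyDropped d

  covered⁺ : ∀ {B x} (d : Dropped B x) → B → Covered _≈_ stages (Dropped.gs⁺ d) x
  covered⁺ {B} d b = covered-map (λ r → r b)
    (Comparison.near⇒covered (under-congruence B) (Dropped.at d) (dropped-near d))

  minimal-at : ∀ {B : Set ℓ} → B → ∀ {k} {σs : Vec Stage k} {gs} →
               Minimal (Under B) σs gs → Minimal _≈_ σs gs
  minimal-at b = minimal-map λ r → r b

  unbounded-≈ : (B : Set ℓ) (l : List Carrier) → (∀ g → Relative.Cont B (Any (g ≈_) l)) → B
  unbounded-≈ B = unbounded B ≈-congruence λ l cover → ⊥-elim (infinite (enumerated⇒finite l cover))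

  choose-≈ : (B : Set ℓ) →
             Relative.Cont B (∃ λ gs → Minimal _≈_ stages gs × Fresh _≈_ B stages gs)
  choose-≈ B = Existence.choose generates B ≈-congruence (unbounded-≈ B) stages

  -- An element covered by the classical choice is coloured outright; any other element is
  -- dropped at no dense proposition.
  ¬dropped⇒¬¬coloured : ∀ {x} → ¬ ClassicallyDropped x → ¬ ¬ Coloured x
  ¬dropped⇒¬¬coloured {x} ¬dropped k = lower (choose-≈ Never λ (gs , minimal , fresh) →
    lift (k (¬dropped , λ m ¬¬b d → ⊥-elim (¬¬b λ b →
      case Comparison.transfer ≈-congruence (minimal-at b (Dropped.minimal⁺ d)) minimal fresh
             (covered⁺ d b) of λ where
        (inj₁ (lift ()))
        (inj₂ cov) → k (covered⇒coloured minimal cov)))))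

  -- Endomorphisms preserving the colouring

  module Endomorphism (φ : Carrier → Carrier) (isEndo : IsEndomorphism G φ)
                      (preserves : Preserves G colouring φ) where

    open GroupMorphisms.IsGroupHomomorphism isEndo using (⟦⟧-cong; homo; ε-homo; ⁻¹-homo)

    φ-value : (t : Fin n → Carrier) → (∀ i → t i ≈ φ (s i)) → ∀ w → value t w ≈ φ ⟦ w ⟧
    φ-value t eq []              = sym ε-homo
    φ-value t eq ((i , true) ∷ w)  = trans (∙-cong (eq i) (φ-value t eq w)) (sym (homo _ _))
    φ-value t eq ((i , false) ∷ w) = trans
      (∙-cong (trans (⁻¹-cong (eq i)) (sym (⁻¹-homo _))) (φ-value t eq w)) (sym (homo _ _))

    private
      encoding = tuple-surjective λ i → proj₁ (generates (φ (s i)))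

    -- The number of a tuple of words for the values `φ (s i)`; thus `B` below expresses that `φ` is
    -- the identity.
    m : ℕ
    m = proj₁ encoding

    B : Set ℓ
    B = Identity m

    tuple≈ : ∀ i → ⟦ tuple n m i ⟧ ≈ φ (s i)
    tuple≈ i = trans (reflexive (≡.cong ⟦_⟧ (proj₂ encoding i))) (proj₂ (generates (φ (s i))))

    substituted≈ : ∀ u → substituted m u ≈ φ (pt u)
    substituted≈ u = φ-value _ tuple≈ (word n u)

    fixes-all : B → ∀ g → φ g ≈ g
    fixes-all b g = let w , w≈g = generates g in
      trans (⟦⟧-cong (sym w≈g)) (trans (sym (φ-value s (λ i → trans (sym (b i)) (tuple≈ i)) w)) w≈g)

    push : ∀ {g} → Coloured g → Coloured (φ g)
    push {g} = Equivalence.from (preserves g)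

    pull : ∀ {g} → Coloured (φ g) → Coloured g
    pull {g} = Equivalence.to (preserves g)

    pt-surjective : ∀ g → ∃ λ u → pt u ≈ g
    pt-surjective g with w , w≈g ← generates g with u , eq ← word-surjective w =
      u , trans (reflexive (≡.cong ⟦_⟧ eq)) w≈g

    -- If φ moves the generator s i, then it moves g or g ∙ s i for every g.
    movable : ∀ i → ¬ ⟦ tuple n m i ⟧ ≈ s i → ∀ D K → ¬ ¬ ∃ (Movable m D K)
    movable i moved D K k = lower (unbounded-≈ Never (l ++ List.map (_∙ s i ⁻¹) l) λ g none →
      let u , u≈ = pt-surjective g
          v , v≈ = pt-surjective (g ∙ s i)
          ∉l : ∀ {x} → x ≈ g → ¬ Any (x ≈_) l
          ∉l x≈g p = lower (none (Anyₚ.++⁺ˡ (Any.map (trans (sym x≈g)) p)))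
          ∉l′ : ∀ {x} → x ≈ g ∙ s i → ¬ Any (x ≈_) l
          ∉l′ x≈gs p = lower (none (Anyₚ.++⁺ʳ l (Anyₚ.map⁺
            (Any.map (Congruence.move-rightˡ ≈-congruence ∘ trans (sym x≈gs)) p))))
          fixed : ∀ x {y} → pt x ≈ y → substituted m x ≈ pt x → φ y ≈ y
          fixed x x≈y e = trans (⟦⟧-cong (sym x≈y)) (trans (sym (substituted≈ x)) (trans e x≈y))
      in lift (k (u , record
        { moved = λ e → k (v , record
          { moved = λ e′ → moved (trans (tuple≈ i) (∙-cancelˡ g _ _ (trans
              (∙-congʳ (sym (fixed u u≈ e))) (trans (sym (homo g (s i))) (fixed v v≈ e′)))))
          ; ∉D = ∉l′ v≈ ∘ Anyₚ.++⁺ˡ ; ∉K = ∉l′ v≈ ∘ Anyₚ.++⁺ʳ D })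
        ; ∉D = ∉l u≈ ∘ Anyₚ.++⁺ˡ ; ∉K = ∉l u≈ ∘ Anyₚ.++⁺ʳ D })))
      where l = D ++ K

    -- If `φ` moved a generator, step `m` of the greedy run would drop exactly one of some word and
    -- its image; the other is coloured up to double negation, against preservation.
    ¬¬identity : ¬ ¬ B
    ¬¬identity ¬b = lower (choose-≈ Never λ (gs , minimal , fresh) → lift (impossible gs minimal fresh))
      where
      open Relative ⊥
      module _ (gs : Choice) (minimal : Minimal _≈_ stages gs) (fresh : Fresh _≈_ Never stages gs) where

        committed : ∀ {j D K x} → State (elements stages gs) j D K → Any (x ≈_) K →
                    ¬ ClassicallyDropped x
        committed st x∈K d
          with Comparison.choice-unique ≈-congruence minimal fresh
                 (ClassicallyDropped.minimal d) (ClassicallyDropped.fresh d)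
        ... | inj₁ (lift ())
        ... | inj₂ ≡.refl = states-disjoint (ClassicallyDropped.state d) st (ClassicallyDropped.∈D d) x∈K

        dropped : ∀ {j D K x} → State (elements stages gs) j D K → Any (x ≈_) D → ¬ Coloured x
        dropped st x∈D (¬dropped , _) =
          ¬dropped (record { minimal = minimal ; fresh = fresh ; state = st ; ∈D = x∈D })

        impossible : ⊥
        impossible = state-exists (elements stages gs) m λ (D , K , st) →
          collectFin (λ i ne → movable i ne D K λ (u , mv) →
            least (λ v → decide (Movable m D K v)) u mv λ (v , mv′ , low) →
            decide (Any (substituted m v ≈_) D) λ where
              (inj₁ ∈D) → let st′ = keep st v (mv′ , low) ∈D in
                ¬dropped⇒¬¬coloured (committed st′ (here refl)) λ col →
                dropped st′ (Any.map (trans (sym (substituted≈ v))) ∈D) (push col)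
              (inj₂ ∉D) → let st′ = drop st v (mv′ , low) ∉D in
                ¬dropped⇒¬¬coloured (committed st′ (here (sym (substituted≈ v)))) λ col →
                dropped st′ (here refl) (pull col))
          ¬b

    open Relative B

    -- A list covering the quotient by K would cover the group itself as soon as `B` holds, and `B`
    -- is not false.
    unbounded⁺ : (l : List Carrier) → (∀ g → Cont (Any (Under B g) l)) → B
    unbounded⁺ = unbounded B (under-congruence B) λ l cover → ⊥-elim (¬¬identity λ b →
      infinite (enumerated⇒finite l λ g → Any.map (λ r → r b) (cover g)))

    module ⁺ = Comparison (under-congruence B)
    open ⁺ using (near₁; near₂)
    module ≈ = Comparison ≈-congruence

    -- Colours near the canonical elements

    module World {gs⁺ gs : Choice}
                 (minimal⁺ : Minimal (Under B) stages gs⁺) (fresh⁺ : Fresh (Under B) B stages gs⁺)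
                 (minimal : Minimal _≈_ stages gs) (fresh : Fresh _≈_ B stages gs) where

      -- If `B` holds, `gs⁺` covers `y` for `≈` as well, so `y` is coloured. As `B` is not false,
      -- this excludes classical dropping outright; the other rules reduce to the one at `B`.
      coloured : ∀ {y} → Covered (Under B) stages gs⁺ y → (Dropped B y → B) → Cont (Coloured y)
      coloured {y} cov ¬dropped k = decide (Covered _≈_ stages gs y) λ where
          (inj₁ cov≈)   → k (covered⇒coloured minimal cov≈)
          (inj₂ ¬cov≈) → k ((λ d → ¬¬identity λ b → proj₁ (once b) d) , rest ¬cov≈)
        where
        once : B → Coloured y
        once b = covered⇒coloured (minimal-at b minimal⁺) (covered-map (λ r → r b) cov)
        -- If y is dropped at Identity j, that proposition is equivalent to B.
        rest : (Covered _≈_ stages gs y → B) →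
               ∀ j → ¬ ¬ Identity j → Dropped (Identity j) y → Identity j
        rest ¬cov≈ j ¬¬b′ d = to (¬dropped (dropped-map from to d))
          where
          to : B → Identity j
          to b = proj₂ (once b) j ¬¬b′ d
          from : Identity j → B
          from b′ = [ id , ¬cov≈ ]′
            (≈.transfer (minimal-at b′ (Dropped.minimal⁺ d)) minimal fresh (covered⁺ d b′))

      -- By uniqueness of the choices and of the stage near `y`, a dropping of `y` can only follow
      -- the rule of the given stage.
      same-place : ∀ {σ g y} → At stages gs⁺ σ g → ⁺.Near σ g y → Dropped B y →
                   B ⊎ Pattern B gs g y σ
      same-place at near d = go d (dropped-near d)
        where
        go : (d : Dropped B _) → ⁺.Near (Dropped.σ d) (Dropped.g d) _ → B ⊎ Pattern B gs _ _ _
        go record { minimal⁺ = h⁺ ; fresh⁺ = f⁺ ; minimal = h ; fresh = f ; at = at′ ; pattern′ = p } near′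
          with ⁺.choice-unique minimal⁺ fresh⁺ h⁺ f⁺ | ≈.choice-unique minimal fresh h f
        ... | inj₁ b      | _           = inj₁ b
        ... | inj₂ _      | inj₁ b      = inj₁ b
        ... | inj₂ ≡.refl | inj₂ ≡.refl with ⁺.at-unique fresh⁺ at near at′ near′
        ...   | inj₁ b      = inj₁ b
        ...   | inj₂ ≡.refl = inj₂ p

      member⇒at : ∀ {k} {σs : Vec Stage k} {σ} → σ Vec∈.∈ σs → ∀ hs → ∃ λ g → At σs hs σ g
      member⇒at (here ≡.refl) (g ∷ hs) = g , here
      member⇒at (there σ∈)    (_ ∷ hs) with g , at ← member⇒at σ∈ hs = g , there at

      -- A big kernel: in suitable cosets a single element is dropped, hence fixed.

      lookup-distinct : ∀ {ks : List Carrier} → AllPairs (λ j k → j ≈ k → B) ks →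
                        ∀ i j → i Fin.< j → List.lookup ks i ≈ List.lookup ks j → B
      lookup-distinct (ds ∷ _)  zero    (suc j) _         e = All.lookup ds (∈-lookup j) e
      lookup-distinct (_ ∷ dss) (suc i) (suc j) (s≤s i<j) e = lookup-distinct dss i j i<j e

      avoid : ∀ e (ks l : List Carrier) → List.length l < List.length ks →
              AllPairs (λ j k → j ≈ k → B) ks → Cont (∃ λ k → k ∈ ks × (Any (e ∙ k ≈_) l → B))
      avoid e ks l l<ks distinct none =
        collectFin (λ i found → none (List.lookup ks i , ∈-lookup i , found)) λ found →
        let i , j , i<j , same = pigeonhole l<ks (Any.index ∘ found)
        in lookup-distinct distinct i j i<j (∙-cancelˡ e _ _ (trans (Anyₚ.lookup-index (found i))
             (trans (reflexive (≡.cong (List.lookup l) same)) (sym (Anyₚ.lookup-index (found j))))))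

      module Large (big : Big B) where

        module _ (r : Carrier) (g : ℕ) (at : At stages gs⁺ (dropping r) g) (r≉ : Under B r ε → B) where

          e : Carrier
          e = el (dropping r) g

          candidate : Cont (∃ (Candidate B gs e r))
          candidate =
            let ks , C< , near , distinct = big
                l = elements stages gs ++ List.map (_∙ r ⁻¹) (elements stages gs)
                |l| : List.length l ≡ C
                |l| = ≡.trans (Listₚ.length-++ (elements stages gs))
                  (≡.cong₂ _+_ (length-elements stages gs)
                    (≡.trans (Listₚ.length-map _ (elements stages gs)) (length-elements stages gs)))
            in avoid e ks l (≡.subst (_< List.length ks) (≡.sym |l|) C<) distinct >>= λ (k , k∈ , ∉l) →
               let a , a≈ = pt-surjective (e ∙ k) in return (a , record
                 { near = λ b → trans a≈ (trans (∙-congˡ (All.lookup near k∈ b)) (identityʳ e))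
                 ; uncovered = λ cov → ∉l (Anyₚ.++⁺ˡ
                     (Any.map (trans (sym a≈)) (covered⇒any ≈-congruence cov)))
                 ; uncovered′ = λ cov → ∉l (Anyₚ.++⁺ʳ (elements stages gs) (Anyₚ.map⁺
                     (Any.map (trans (sym a≈) ∘ Congruence.move-rightˡ ≈-congruence)
                       (covered⇒any ≈-congruence cov)))) })

          module _ (a : ℕ) (cand : Candidate B gs e r a)
                   (low : ∀ a′ → a′ < a → Candidate B gs e r a′ → B) where

            open Candidate cand

            distinct-copies : Under B (pt a) (pt a ∙ r) → B
            distinct-copies p = r≉ λ b → sym (∙-cancelˡ (pt a) ε r (trans (identityʳ _) (p b)))

            same-copy : ∀ {x y} → Under B x y → x ≈ pt a ⊎ x ≈ pt a ∙ r → y ≈ pt a ⊎ y ≈ pt a ∙ r →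
                        B ⊎ x ≈ y
            same-copy _ (inj₁ p) (inj₁ q) = inj₂ (trans p (sym q))
            same-copy _ (inj₂ p) (inj₂ q) = inj₂ (trans p (sym q))
            same-copy u (inj₁ p) (inj₂ q) = inj₁ (distinct-copies λ b → trans (sym p) (trans (u b) q))
            same-copy u (inj₂ p) (inj₁ q) =
              inj₁ (distinct-copies λ b → trans (sym q) (trans (sym (u b)) p))

            near-e : ∀ {x} → x ≈ pt a ⊎ x ≈ pt a ∙ r → ⁺.Near (dropping r) g x
            near-e (inj₁ p) = near₁ λ b → trans p (near b)
            near-e (inj₂ p) = near₂ λ b → trans p (∙-congʳ (near b))

            -- `φ` keeps `x` in its coset modulo K, where this stage drops nothing else: the other
            -- copy lies in a different coset, `r` being outside K. If `φ` moved `x`, then `φ x`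
            -- would be coloured while `x` is dropped.
            fixed : ∀ {x} → x ≈ pt a ⊎ x ≈ pt a ∙ r → Cont (φ x ≈ x)
            fixed {x} copy moved =
              coloured (⁺.near⇒covered at near-φx) ¬dropped λ col →
              proj₂ (pull col) m ¬¬identity (record
                { minimal⁺ = minimal⁺ ; fresh⁺ = fresh⁺ ; minimal = minimal ; fresh = fresh ; at = at
                ; pattern′ = large big r≉ a cand low copy
                ; uncovered = [ (λ p → uncovered ∘ ≈.covered-resp (sym p))
                              , (λ p → uncovered′ ∘ ≈.covered-resp (sym p)) ]′ copy })
              where
              near-φx : ⁺.Near (dropping r) g (φ x)
              near-φx = case near-e copy of λ where
                (near₁ p) → near₁ λ b → trans (fixes-all b x) (p b)
                (near₂ p) → near₂ λ b → trans (fixes-all b x) (p b)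
              ¬dropped : Dropped B (φ x) → B
              ¬dropped d with same-place at near-φx d
              ... | inj₁ b = b
              ... | inj₂ (large _ _ a′ cand′ low′ copy′) with ℕ.<-cmp a a′
              ...   | tri< a<a′ _ _ = low′ a a<a′ cand
              ...   | tri> _ _ a′<a = low a′ a′<a cand′
              ...   | tri≈ _ ≡.refl _ =
                [ id , moved ]′ (same-copy (λ b → fixes-all b x) copy′ copy)

        fixed-ratio : ∀ {r} → dropping r Vec∈.∈ stages → (Under B r ε → B) → Cont (φ r ≈ r)
        fixed-ratio {r} r∈ r≉ =
          let g , at = member⇒at r∈ gs⁺ in
          candidate r g at r≉ >>= λ (a₀ , cand₀) →
          least (λ a → decide (Candidate B gs (e r g at r≉) r a)) a₀ cand₀ >>= λ (a , cand , low) →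
          fixed r g at r≉ a cand low (inj₁ refl) >>= λ φa →
          fixed r g at r≉ a cand low (inj₂ refl) >>= λ φar →
          return (∙-cancelˡ (pt a) _ _ (trans (∙-congʳ (sym φa)) (trans (sym (homo _ _)) φar)))

        generator∈ : ∀ i → dropping (s i) Vec∈.∈ stages
        generator∈ i = Vec∈ₚ.∈-++⁺ʳ (Vec.map keeping keepingWords)
          (Vec∈ₚ.∈-++⁺ˡ (Vec∈ₚ.∈-map⁺ (dropping ∘ s) (Vec∈ₚ.∈-allFin⁺ i)))

        product∈ : ∀ i j → dropping (s i ∙ s j) Vec∈.∈ stages
        product∈ i j = Vec∈ₚ.∈-++⁺ʳ (Vec.map keeping keepingWords)
          (Vec∈ₚ.∈-++⁺ʳ (Vec.map (dropping ∘ s) (Vec.allFin n))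
            (Vec∈ₚ.∈-map⁺ _ (Vec∈ₚ.∈-allPairs⁺ (Vec∈ₚ.∈-allFin⁺ i) (Vec∈ₚ.∈-allFin⁺ j))))

        kernel-words : (∀ i → Under B (s i) ε) → ∀ w → Under B ⟦ w ⟧ ε
        kernel-words triv []              b = refl
        kernel-words triv ((i , true) ∷ w)  b =
          trans (∙-cong (triv i b) (kernel-words triv w b)) (identityʳ ε)
        kernel-words triv ((i , false) ∷ w) b =
          trans (∙-cong (trans (⁻¹-cong (triv i b)) ε⁻¹≈ε) (kernel-words triv w b)) (identityʳ ε)

        -- If all generators lay in K, the list `[ ε ]` would cover the group modulo K.
        generator-outside : Cont (∃ λ i → Under B (s i) ε → B)
        generator-outside none = collectFin (λ i ¬triv → none (i , ¬triv)) λ triv →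
          unbounded⁺ [ ε ] λ g k → let w , w≈g = generates g in
          k (here λ b → trans (sym w≈g) (kernel-words triv w b))

        -- A generator s j inside the kernel is the quotient of s i ∙ s j and s i, both outside it.
        fixed-generator : ∀ j → Cont (φ (s j) ≈ s j)
        fixed-generator j = decide (Under B (s j) ε) >>= λ where
          (inj₂ outside) → fixed-ratio (generator∈ j) outside
          (inj₁ inside)  → generator-outside >>= λ (i , outside) →
            fixed-ratio (generator∈ i) outside >>= λ φi →
            fixed-ratio (product∈ i j)
              (λ p → outside λ b → trans (sym (trans (∙-congˡ (inside b)) (identityʳ _))) (p b))
              >>= λ φij →
            return (∙-cancelˡ (s i) _ _ (trans (∙-congʳ (sym φi)) (trans (sym (homo _ _)) φij)))

        conclusion : B
        conclusion = collectFin fixed-generator λ fixed i → trans (tuple≈ i) (fixed i)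

      -- A small kernel: the chosen elements are fixed.

      module Small (¬big : Big B → B) where

        Kernel : List Carrier → Set (c ⊔ ℓ)
        Kernel ks = All (λ k → Under B k ε) ks × AllPairs (λ j k → j ≈ k → B) ks

        Exhaustive : List Carrier → Set (c ⊔ ℓ)
        Exhaustive ks = ∀ k → Under B k ε → Cont (Any (k ≈_) ks)

        -- New kernel elements are added while there are any; `fuel` runs out only at `suc C` of
        -- them, which would make the kernel big.
        exhaust : ∀ fuel ks → Kernel ks → List.length ks + fuel ≡ suc C →
                  Cont (∃ λ ks → List.length ks ≤ C × Kernel ks × Exhaustive ks)
        exhaust zero ks (near , distinct) eq _ =
          ¬big (ks , ℕ.≤-reflexive (≡.trans (≡.sym eq) (ℕ.+-identityʳ _)) , near , distinct)
        exhaust (suc fuel) ks kernel@(near , distinct) eq =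
          decide (∃ λ k → Under B k ε × All (λ j → k ≈ j → B) ks) >>= λ where
            (inj₁ (k , k≈ , new)) → exhaust fuel (k ∷ ks) (k≈ ∷ near , new ∷ distinct)
              (≡.trans (≡.sym (ℕ.+-suc _ fuel)) eq)
            (inj₂ none) → return (ks
              , ℕ.≤-trans (ℕ.m≤m+n _ fuel)
                  (ℕ.≤-reflexive (ℕ.suc-injective (≡.trans (≡.sym (ℕ.+-suc _ fuel)) eq)))
              , kernel
              , λ k k≈ absent → none (k , k≈ , All.tabulate λ j∈ k≈j → absent (lose j∈ k≈j)))

        -- The free group acts on the kernel by w · k = φ w ∙ k ∙ w⁻¹, and words acting trivially on
        -- it are fixed by φ.
        module KernelAction {d : ℕ} (elem : Fin d → Carrier)
          (near : ∀ x → Under B (elem x) ε)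
          (distinct : ∀ x y → elem x ≈ elem y → B ⊎ x ≡ y)
          (exhaustive : ∀ k → Under B k ε → Cont (∃ λ x → k ≈ elem x)) where

          twist : Carrier → Carrier → Carrier
          twist g k = φ g ∙ k ∙ g ⁻¹

          twist-near : ∀ g x → Under B (twist g (elem x)) ε
          twist-near g x b = trans
            (∙-congʳ (trans (∙-cong (fixes-all b g) (near x b)) (identityʳ g))) (inverseʳ g)

          twist-cong : ∀ {g h j k} → g ≈ h → j ≈ k → twist g j ≈ twist h k
          twist-cong p q = ∙-cong (∙-cong (⟦⟧-cong p) q) (⁻¹-cong p)

          twist-∙ : ∀ g h k → twist (g ∙ h) k ≈ twist g (twist h k)
          twist-∙ g h k = begin
            φ (g ∙ h) ∙ k ∙ (g ∙ h) ⁻¹          ≈⟨ ∙-cong (∙-congʳ (homo g h)) (⁻¹-anti-homo-∙ g h) ⟩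
            φ g ∙ φ h ∙ k ∙ (h ⁻¹ ∙ g ⁻¹)       ≈⟨ assoc _ _ _ ⟨
            φ g ∙ φ h ∙ k ∙ h ⁻¹ ∙ g ⁻¹         ≈⟨ ∙-congʳ (∙-congʳ (assoc _ _ _)) ⟩
            φ g ∙ (φ h ∙ k) ∙ h ⁻¹ ∙ g ⁻¹       ≈⟨ ∙-congʳ (assoc _ _ _) ⟩
            φ g ∙ (φ h ∙ k ∙ h ⁻¹) ∙ g ⁻¹       ∎
            where open import Relation.Binary.Reasoning.Setoid setoid

          twist-ε : ∀ k → twist ε k ≈ k
          twist-ε k = trans (∙-cong (trans (∙-congʳ ε-homo) (identityˡ k)) ε⁻¹≈ε) (identityʳ k)

          module _ (forward  : ∀ i x → ∃ λ y → twist (s i) (elem x) ≈ elem y)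
                   (backward : ∀ i x → ∃ λ y → twist (s i ⁻¹) (elem x) ≈ elem y) where

            α β : Table n d
            α = Vec.tabulate λ i → Vec.tabulate λ x → proj₁ (forward i x)
            β = Vec.tabulate λ i → Vec.tabulate λ x → proj₁ (backward i x)

            open Action α β

            lookup-table : (f : Fin n → Fin d → Fin d) → ∀ i x →
              Vec.lookup (Vec.lookup (Vec.tabulate λ i → Vec.tabulate (f i)) i) x ≡ f i x
            lookup-table f i x = ≡.trans
              (≡.cong (λ row → Vec.lookup row x) (Vecₚ.lookup∘tabulate (λ i → Vec.tabulate (f i)) i))
              (Vecₚ.lookup∘tabulate (f i) x)

            actLetter-twist : ∀ l x → elem (actLetter l x) ≈ twist (letterValue s l) (elem x)
            actLetter-twist (i , true)  x =
              trans (reflexive (≡.cong elem (lookup-table _ i x))) (sym (proj₂ (forward i x)))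
            actLetter-twist (i , false) x =
              trans (reflexive (≡.cong elem (lookup-table _ i x))) (sym (proj₂ (backward i x)))

            act-twist : ∀ w x → elem (act w x) ≈ twist ⟦ w ⟧ (elem x)
            act-twist []      x = sym (twist-ε _)
            act-twist (l ∷ w) x = trans (actLetter-twist l _)
              (trans (twist-cong refl (act-twist w x)) (sym (twist-∙ _ _ _)))

            cancels : ∀ l l′ → letterValue s l ∙ letterValue s l′ ≈ ε →
                      ∀ x → B ⊎ actLetter l (actLetter l′ x) ≡ x
            cancels l l′ eq x = distinct _ _ (trans (actLetter-twist l _)
              (trans (twist-cong refl (actLetter-twist l′ x))
                (trans (sym (twist-∙ _ _ _)) (trans (twist-cong eq refl) (twist-ε _)))))

            mutually-inverse : B ⊎ Inverse
            mutually-inverse = alternatives λ i → alternatives λ x →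
              case cancels (i , true) (i , false) (inverseʳ _) x of λ where
                (inj₁ b) → inj₁ b
                (inj₂ p) → Sum.map₂ (p ,_) (cancels (i , false) (i , true) (inverseˡ _) x)

          trivial-fixed : (k : Fin (suc C)) → toℕ k ≡ d →
                          Cont (∀ q → Trivial n C q → φ ⟦ q ⟧ ≈ ⟦ q ⟧)
          trivial-fixed k ≡.refl =
            collectFin (λ i → collectFin λ x → exhaustive _ (twist-near (s i) x)) >>= λ forward →
            collectFin (λ i → collectFin λ x → exhaustive _ (twist-near (s i ⁻¹) x)) >>= λ backward →
            -- At the point representing `ε`, triviality of the action says that φ(q) q⁻¹ is the
            -- unit.
            exhaustive ε (λ _ → refl) >>= λ (x , ε≈x) →
            λ use → case mutually-inverse forward backward of λ where
              (inj₁ b)   → b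
              (inj₂ both) → use λ q trivial →
                let fixed = trans (sym (act-twist forward backward q x)) (reflexive (≡.cong elem
                      (trivial-acts n C trivial k (α forward backward) (β forward backward) both x)))
                in x∙y⁻¹≈ε⇒x≈y _ _ (trans (∙-congʳ (sym (identityʳ _)))
                     (trans (twist-cong refl ε≈x) (trans fixed (sym ε≈x))))

        trivial-words : Cont (∀ q → Trivial n C q → φ ⟦ q ⟧ ≈ ⟦ q ⟧)
        trivial-words = exhaust (suc C) [] ([] , []) ≡.refl >>= λ (ks , |ks|≤C , (near , distinct) , all) →
          KernelAction.trivial-fixed (List.lookup ks)
            (λ x → All.lookup near (∈-lookup x))
            (λ x y e → case <-cmp x y of λ where
              (tri< x<y _ _) → inj₁ (lookup-distinct distinct x y x<y e)
              (tri≈ _ x≡y _) → inj₂ x≡y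
              (tri> _ _ y<x) → inj₁ (lookup-distinct distinct y x y<x (sym e)))
            (λ k k≈ → all k k≈ >>= λ found → return (Any.index found , Anyₚ.lookup-index found))
            (fromℕ< (s≤s |ks|≤C)) (toℕ-fromℕ< (s≤s |ks|≤C))

        chosen-coloured : ∀ {v g} → At stages gs⁺ (keeping v) g → Cont (Coloured (el (keeping v) g))
        chosen-coloured at = coloured (⁺.near⇒covered at (near₁ λ _ → refl)) λ d →
          case same-place at (near₁ λ _ → refl) d of λ where
            (inj₁ b)                 → b
            (inj₂ (small _ _ other)) → other refl

        -- Any other member of the coset is dropped at `B`; being coloured, it then proves `B`.
        settle : ∀ {v g y} → At stages gs⁺ (keeping v) g → Under B y (el (keeping v) g) → Coloured y →
                 Cont (y ≈ el (keeping v) g ⊎ Covered _≈_ stages gs y)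
        settle {v} {g} {y} at near (_ , col) =
          decide (y ≈ el (keeping v) g) >>= λ where
            (inj₁ same)  → return (inj₁ same)
            (inj₂ other) → decide (Covered _≈_ stages gs y) >>= λ where
              (inj₁ cov)  → return (inj₂ cov)
              (inj₂ ¬cov) → λ _ → col m ¬¬identity (record
                { minimal⁺ = minimal⁺ ; fresh⁺ = fresh⁺ ; minimal = minimal ; fresh = fresh ; at = at
                ; pattern′ = small ¬big near other ; uncovered = ¬cov })

        covered-head : ∀ {k v g} {σs : Vec Stage k} {hs y} →
                       Covered _≈_ (keeping v ∷ σs) (g ∷ hs) y → y ≈ el (keeping v) g ⊎ Covered _≈_ σs hs y
        covered-head (first e)  = inj₁ e
        covered-head (second e) = inj₁ (trans e (identityʳ _))
        covered-head (later q)  = inj₂ q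
        covered-head (later⁻ q) =
          inj₂ (≈.covered-resp (sym (trans (∙-congˡ ε⁻¹≈ε) (identityʳ _))) q)
        covered-head (later⁺ q) = inj₂ (≈.covered-resp (sym (identityʳ _)) q)

        -- The choices for the finer congruence _≈_ that lie in the coset of the head of hs⁺ come from
        -- the same stage or a later one.
        match-head : ∀ {k v g⁺ g} {σs : Vec Stage k} {hs⁺ hs y} →
                     Minimal (Under B) (keeping v ∷ σs) (g⁺ ∷ hs⁺) →
                     Fresh (Under B) B (keeping v ∷ σs) (g⁺ ∷ hs⁺) →
                     Minimal _≈_ (keeping v ∷ σs) (g ∷ hs) →
                     Under B y (el (keeping v) g⁺) → Covered _≈_ (keeping v ∷ σs) (g ∷ hs) y →
                     B ⊎ y ≈ el (keeping v) g⁺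
        match-head {v = v} {g⁺} {g} (l⁺ ∷ ms⁺) (f ∷ fs) minimal′ near cov
          with minimal-map {R′ = Under B} (λ p _ → p) minimal′ | covered-head cov
        ... | l ∷ ms | inj₂ later-cov =
          inj₁ ([ id , f ∘ stale₁ ∘ ⁺.covered-resp (λ b → sym (near b)) ]′
            (⁺.transfer ms ms⁺ fs (covered-map (λ p _ → p) later-cov)))
        ... | l ∷ ms | inj₁ e with ⁺.transfer-head l ms l⁺ ms⁺ f fs
        ...   | inj₁ b              = inj₁ b
        ...   | inj₂ (inj₁ ≡.refl)  = inj₂ e
        ...   | inj₂ (inj₂ stale)   = inj₁ (f (stale-transport stale))
          where
          stale-transport : Stale (Under B) _ _ (keeping v) g → Stale (Under B) _ _ (keeping v) g⁺
          stale-transport (stale₁ q) = stale₁ (⁺.covered-resp (λ b → trans (sym (near b)) e) q)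
          stale-transport (stale₂ q) =
            stale₂ (⁺.covered-resp (λ b → ∙-congʳ (trans (sym (near b)) e)) q)

        module _ (trivial : ∀ q → Trivial n C q → φ ⟦ q ⟧ ≈ ⟦ q ⟧) where

          prefix-fixed : ∀ v g → Trivial n C (word n g) → φ (el (keeping v) g) ≈ el (keeping v) g →
                         φ ⟦ v ⟧ ≈ ⟦ v ⟧
          prefix-fixed v g t e =
            ∙-cancelʳ _ _ _ (trans (∙-congˡ (sym (trivial _ t))) (trans (sym (homo _ _)) e))

          chosen-fixed : ∀ v g → Trivial n C (word n g) → φ ⟦ v ⟧ ≈ ⟦ v ⟧ →
                         φ (el (keeping v) g) ≈ el (keeping v) g
          chosen-fixed v g t e = trans (homo _ _) (∙-cong e (trivial _ t))

          module _ (injective : ∀ κ → φ κ ≈ ε → Cont (κ ≈ ε)) where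

            -- Later stages come first: by the time a stage is treated, any other element kept in
            -- its coset is already known to be fixed.
            descend : ∀ {j k} (vs : Vec (FreeWord n) j) (rest : Vec Stage k) {hs⁺ hs} →
                      (∀ {σ g} → At (Vec.map keeping vs Vec.++ rest) hs⁺ σ g → At stages gs⁺ σ g) →
                      Minimal (Under B) (Vec.map keeping vs Vec.++ rest) hs⁺ →
                      Fresh (Under B) B (Vec.map keeping vs Vec.++ rest) hs⁺ →
                      Minimal _≈_ (Vec.map keeping vs Vec.++ rest) hs →
                      (∀ {z} → Covered _≈_ stages gs z →
                        Covered _≈_ (Vec.map keeping vs Vec.++ rest) hs z ⊎ φ z ≈ z) →
                      Cont (∀ {v} → v Vec∈.∈ vs → φ ⟦ v ⟧ ≈ ⟦ v ⟧)
            descend []       rest at ms⁺ fs ms known = return λ ()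
            descend (v ∷ vs) rest {g⁺ ∷ hs⁺} {g ∷ hs} at ms⁺@(l⁺ ∷ ms⁺′) fs@(f ∷ fs′) ms@(l ∷ ms′) known =
              chosen-coloured (at here) >>= λ col →
              settle (at here) (λ b → fixes-all b γ) (push col) >>= λ settled →
              φγ≈γ settled >>= λ φγ →
              let φv = prefix-fixed v g⁺ (Lowest.member l⁺) φγ in
              descend vs rest (at ∘ there) ms⁺′ fs′ ms′
                -- The choice for `≈` at this stage is `v` times a trivial word, so it is fixed
                -- along with `v`.
                (λ cov → [ (λ here-cov → case covered-head here-cov of λ where
                             (inj₁ e)    → inj₂ (trans (⟦⟧-cong e)
                                             (trans (chosen-fixed v g (Lowest.member l) φv) (sym e)))
                             (inj₂ cov′) → inj₁ cov′)
                         , inj₂ ]′ (known cov)) >>= λ fixed →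
              return λ { (here ≡.refl) → φv ; (there v∈) → fixed v∈ }
              where
              γ = el (keeping v) g⁺
              φγ≈γ : φ γ ≈ γ ⊎ Covered _≈_ stages gs (φ γ) → Cont (φ γ ≈ γ)
              φγ≈γ (inj₁ e)   = return e
              φγ≈γ (inj₂ cov) with known cov
              ... | inj₁ cov′ = λ k → [ id , k ]′ (match-head ms⁺ fs ms (λ b → fixes-all b γ) cov′)
              -- Here `φ γ` is already fixed, so it has the same image as `γ`, and injectivity
              -- identifies the two.
              ... | inj₂ e    = injective (φ γ ∙ γ ⁻¹)
                    (trans (homo _ _) (trans (∙-cong e (⁻¹-homo γ)) (inverseʳ _))) >>= λ p →
                  return (x∙y⁻¹≈ε⇒x≈y _ _ p)

        -- As `φ` is the identity modulo K, `κ` lies in K and `γ ∙ κ` in the coset of the chosen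
        -- `γ`. Both have the same image, so `γ ∙ κ` is coloured as `γ` is. At the head stage
        -- `match-head` applies to everything that `gs` covers, so `γ` is the only coloured element
        -- of its coset, up to `B`.
        first-injective : ∀ {k v g⁺ g} {σs : Vec Stage k} {hs⁺ hs} →
                          (∀ {σ h} → At (keeping v ∷ σs) (g⁺ ∷ hs⁺) σ h → At stages gs⁺ σ h) →
                          Minimal (Under B) (keeping v ∷ σs) (g⁺ ∷ hs⁺) →
                          Fresh (Under B) B (keeping v ∷ σs) (g⁺ ∷ hs⁺) →
                          Minimal _≈_ (keeping v ∷ σs) (g ∷ hs) →
                          (∀ {z} → Covered _≈_ stages gs z → Covered _≈_ (keeping v ∷ σs) (g ∷ hs) z) →
                          ∀ κ → φ κ ≈ ε → Cont (κ ≈ ε)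
        first-injective {v = v} {g⁺} at ms⁺ fs ms known κ φκ≈ε =
          chosen-coloured (at here) >>= λ col →
          settle (at here) near (pull (TwoColoring.respect colouring φγ≈φγκ (push col))) >>= λ where
            (inj₁ e)   → return (identityʳ-unique γ κ e)
            (inj₂ cov) → λ k → [ id , k ∘ identityʳ-unique γ κ ]′ (match-head ms⁺ fs ms near (known cov))
          where
          γ = el (keeping v) g⁺
          near : Under B (γ ∙ κ) γ
          near b = trans (∙-congˡ (trans (sym (fixes-all b κ)) φκ≈ε)) (identityʳ γ)
          φγ≈φγκ : φ γ ≈ φ (γ ∙ κ)
          φγ≈φγκ = sym (trans (homo γ κ) (trans (∙-congˡ φκ≈ε) (identityʳ _)))

      conclusion : B
      conclusion = decide (Big B) λ where
          (inj₁ big)  → Large.conclusion big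
          (inj₂ ¬big) → fromSmall ¬big gs⁺ gs ≡.refl ≡.refl
        where
        fromSmall : (Big B → B) → ∀ hs⁺ hs → hs⁺ ≡ gs⁺ → hs ≡ gs → B
        fromSmall ¬big (_ ∷ _) (_ ∷ _) ≡.refl ≡.refl =
          trivial-words λ trivial →
          descend trivial (first-injective id minimal⁺ fresh⁺ minimal id)
            keepingWords droppingStages id minimal⁺ fresh⁺ minimal inj₁ λ fixed i →
          trans (tuple≈ i) (trans (⟦⟧-cong (sym (identityʳ _)))
            (trans (fixed (there (Vec∈ₚ.∈-map⁺ _ (Vec∈ₚ.∈-allFin⁺ i)))) (identityʳ _)))
          where open Small ¬big

    φ-identity : ∀ g → φ g ≈ g
    φ-identity = fixes-all (
      Existence.choose generates B (under-congruence B) unbounded⁺ stages λ (gs⁺ , minimal⁺ , fresh⁺) →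
      choose-≈ B λ (gs , minimal , fresh) →
      World.conclusion minimal⁺ fresh⁺ minimal fresh)

theorem6 : {c ℓ : Level} (G : Group c ℓ) →
    FinitelyGenerated G → Infinite G → EndoTwoDistinguishable G
theorem6 G (n , s , generating) infinite = colouring , Endomorphism.φ-identity
  where
  open Group G
  open Evaluation G
  generates : ∀ g → ∃ λ (w : FreeWord n) → value s w ≈ g
  generates g = let w , w≈g = generating g in flatten w , trans (value-flatten s w) w≈g
  open Colouring G s generates infinite
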